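{- Let $k\geq 2$ and let $\mathcal Q_k$ be the set of partitions of $[2k+1]$ into $k$ blocks of size $2$ and one singleton. Call $\mathcal F\subseteq\mathcal Q_k$ intersecting if any two members of $\mathcal F$ have at least one block in common. If $\mathcal F\subseteq\mathcal Q_k$ is intersecting, then $|\mathcal F|\leq(2k-1)!!$. Moreover, equality holds if and only if $\mathcal F$ is an orbit of size $(2k-1)!!$ of a conjugate of the Young subgroup $\operatorname{Sym}([2k,1])=\operatorname{Sym}(\{1,\dots,2k\})\times\operatorname{Sym}(\{2k+1\})$ or of a conjugate of the Young subgroup $\operatorname{Sym}([2k-1,2])=\operatorname{Sym}(\{1,\dots,2k-1\})\times\operatorname{Sym}(\{2k,2k+1\})$, acting naturally on $\mathcal Q_k$.
   Context: $m!!$ denotes the product $m(m-2)(m-4)\cdots$ down to $1$ or $2$. -}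

module Defs where

open import Data.Nat using (ℕ; zero; suc; _*_; _<_; _≤_; _∸_)
open import Data.Fin using (Fin; toℕ; _≟_)
open import Data.Fin.Subset using (Subset)
open import Data.Fin.Permutation using (Permutation′; _⟨$⟩ʳ_; _⟨$⟩ˡ_; _∘ₚ_; flip)
open import Data.Sum using (_⊎_)
open import Data.Vec using (Vec; lookup; tabulate)
open import Data.Bool using (_∨_)
open import Data.List using (List; length)
open import Data.List.Membership.Propositional using (_∈_)
open import Data.Product using (Σ; ∃; ∃-syntax; _×_)
open import Relation.Binary.PropositionalEquality using (_≡_)
open import Relation.Nullary.Decidable using (⌊_⌋)
open import Function.Bundles using (_⇔_)

_!! : ℕ → ℕ
zero !! = 1
suc zero !! = 1
suc (suc m) !! = suc (suc m) * (m !!)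

-- Ground set [2k+1] is modelled as Fin (suc (2 * k)); paper's point i is index i-1.
-- A partition of Fin n into blocks of size ≤ 2 is encoded by its "partner" table P:
-- the block containing x is {x, P x}.
Partner : ℕ → Set
Partner n = Vec (Fin n) n

blockOf : ∀ {n} → Partner n → Fin n → Subset n
blockOf P x = tabulate (λ y → ⌊ y ≟ x ⌋ ∨ ⌊ y ≟ lookup P x ⌋)

-- P describes a partition of Fin n into pairs and exactly one singleton:
-- partner relation symmetric (involution), and exactly one point is its own partner.
IsQ : ∀ {n} → Partner n → Set
IsQ P = (∀ x → lookup P (lookup P x) ≡ x)
      × (∃[ c ] (lookup P c ≡ c × (∀ y → lookup P y ≡ y → y ≡ c)))

ShareBlock : ∀ {n} → Partner n → Partner n → Set
ShareBlock P Q = ∃[ x ] (blockOf P x ≡ blockOf Q x)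

Intersecting : ∀ {n} → List (Partner n) → Set
Intersecting F = ∀ {P Q} → P ∈ F → Q ∈ F → ShareBlock P Q

-- natural action of Sym(n) on partitions: the block {x, P x} goes to {σ x, σ (P x)}
act : ∀ {n} → Permutation′ n → Partner n → Partner n
act σ P = tabulate (λ x → σ ⟨$⟩ʳ lookup P (σ ⟨$⟩ˡ x))

Young : ∀ {n} → ℕ → Permutation′ n → Set
Young m σ = ∀ x → (toℕ x < m) ⇔ (toℕ (σ ⟨$⟩ʳ x) < m)

-- membership in a conjugate of H (σ ↦ g σ g⁻¹ in some order; g ranges over all perms) of a subgroup H
Conj : ∀ {n} → Permutation′ n → (Permutation′ n → Set) → Permutation′ n → Set
Conj g H σ = H (flip g ∘ₚ σ ∘ₚ g)

IsOrbit : ∀ {n} → (Permutation′ n → Set) → List (Partner n) → Set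
IsOrbit H F = ∃[ P ] (IsQ P × (∀ Q → (Q ∈ F) ⇔ (∃[ σ ] (H σ × Q ≡ act σ P))))

Extremal : (k : ℕ) → List (Partner (suc (2 * k))) → Set
Extremal k F = length F ≡ (2 * k ∸ 1) !!
  × ∃[ g ] (IsOrbit (Conj g (Young (2 * k))) F ⊎ IsOrbit (Conj g (Young (2 * k ∸ 1))) F)

{-# OPTIONS --safe #-}

-- Matching the singleton with an extra point ∞ turns partitions into perfect matchings of K_N, N = 2k+2,
-- and a common block into a common edge.
--
-- Bound: let C be N−1 pairwise disjoint matchings. Every translate πC meets an intersecting family F at most
-- once; averaging over all π gives (N−1)|F| ≤ (N−1)!!, and in case of equality every πC meets F exactly once.
--
-- Equality, k ≥ 3: choose C with two members M₁, M₂ whose union contains a 4-cycle and is not just that cycle.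
-- Exchanging M₁ and M₂ along the cycle gives another such C, so the indicator f of F satisfies
-- f(πM₁) + f(πM₂) = f(πM₁′) + f(πM₂′) for all π. Let σ, τ be the transpositions of the ends of an M₁-edge on the
-- cycle and of one off the cycle: τ fixes M₁ and M₁′, σ fixes M₂′ and τM₂′, and two subtractions leave
-- f(M) − f(σM) − f(τM) + f(στM) = 0 for all M and all σ = (p q), τ = (u v) with p, q, u, v on distinct edges of M.
-- F is not closed under all such swaps, since swaps make M disjoint from a given matching; so M ∈ F and
-- σM ∉ F for some σ = (p q). By the identity this persists when other edges of M are swapped, hence every member
-- of F contains the edge of M at p or the one at q, and a second application leaves a single edge.
-- For k = 2 any three pairwise intersecting matchings of K₆ share an edge.
--
-- All partitions with a given block form an intersecting family, so by the bound a maximum F consists of all of them.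

module Submission where

open import Defs
open import Data.Nat using (ℕ; suc; _*_; _≤_; _∸_)
open import Data.List using (List; length)
open import Data.List.Relation.Unary.All using (All)
open import Data.List.Relation.Unary.Unique.Propositional using (Unique)
open import Data.Product using (_×_)
open import Relation.Binary.PropositionalEquality using (_≡_)
open import Function.Bundles using (_⇔_)
open import Algebra.Bundles using (AbelianGroup)
import Algebra.Properties.AbelianGroup as AbelianGroupProperties
open import Algebra.Properties.CommutativeSemigroup using (interchange)
open import Data.Bool using (true; _∨_)
open import Data.Empty using (⊥; ⊥-elim)
open import Data.Fin using (Fin; zero; suc; _≟_; toℕ; fromℕ; fromℕ<; inject₁)
open import Data.Fin.Permutation
  using (Permutation′; permutation; transpose; _⟨$⟩ʳ_; _⟨$⟩ˡ_; _∘ₚ_; flip; inverseˡ; inverseʳ)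
  renaming (id to idₚ; _≈_ to _≈ₚ_)
import Data.Fin.Properties as Fin
open import Data.Fin.Properties
  using (all?; any?; pigeonhole; toℕ-fromℕ; toℕ-fromℕ<; toℕ-inject₁; toℕ-injective; toℕ<n; +↔⊎)
open import Data.List as List using ([]; _∷_; _++_; map; filter; cartesianProduct; cartesianProductWith; allFin)
import Data.List.Membership.DecPropositional as DecMembership
open import Data.List.Membership.Propositional using (_∈_; _∉_; find)
open import Data.List.Membership.Propositional.Properties
  using (∈-allFin; ∈-cartesianProduct⁺; ∈-cartesianProductWith⁺; ∈-filter⁺; ∈-filter⁻; ∈-map⁺; ∈-map⁻)
open import Data.List.Membership.Propositional.Properties.WithK using (unique∧set⇒bag)
open import Data.List.Properties using (length-++; length-map; length-tabulate; map-∘)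
open import Data.List.Relation.Binary.BagAndSetEquality using (∼bag⇒↭)
import Data.List.Relation.Binary.Permutation.Propositional.Properties as Perm
open import Data.List.Relation.Unary.All as All using ([]; _∷_)
import Data.List.Relation.Unary.All.Properties as All
open import Data.List.Relation.Unary.AllPairs as AllPairs using (AllPairs; []; _∷_)
import Data.List.Relation.Unary.AllPairs.Properties as AllPairs
open import Data.List.Relation.Unary.Any using (here; there; index)
open import Data.List.Relation.Unary.Any.Properties using (lookup-index)
import Data.List.Relation.Unary.Unique.Propositional.Properties as Unique
open import Data.Nat using (zero; _+_; _<_; _%_; z≤n; s≤s; >-nonZero)
open import Data.Nat.Divisibility using (m%n≡0⇒n∣m; divides)
open import Data.Nat.DivMod using (%-distribˡ-+; m%n<n; m<n⇒m%n≡m; n%n≡0)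
open import Data.Nat.ListAction using (sum)
open import Data.Nat.ListAction.Properties using (sum-↭)
import Data.Nat.Properties as ℕ
open import Data.Nat.Properties using
  (*-assoc; *-cancelʳ-≤; *-cancelˡ-≤; *-identityʳ; *-mono-≤; *-monoˡ-≤; *-zeroʳ; +-assoc; +-cancelʳ-≡;
   +-cancelʳ-≤; +-cancelˡ-≤; +-comm; +-commutativeSemigroup; +-identityʳ; +-mono-<; +-mono-≤;
   +-monoʳ-≤; +-monoˡ-≤; +-suc; <⇒≤; <⇒≱; even≢odd; m+n≡0⇒m≡0; m∸n+n≡m; m≤m+n; m≤n+m; n<1+n; n≤1+n;
   ≤-antisym; ≤-pred; ≤-reflexive; ≤-trans; ≤∧≢⇒<; module ≤-Reasoning)
open import Data.Product using (_,_; proj₁; proj₂; ∃-syntax; Σ-syntax)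
open import Data.Sum using (_⊎_; inj₁; inj₂)
open import Data.Sum.Properties using (inj₁-injective; inj₂-injective)
open import Data.Vec using (Vec; []; _∷_; lookup)
import Data.Vec as Vec
open import Data.Vec.Properties using (lookup∘tabulate; tabulate∘lookup; tabulate-cong; ≡-dec)
open import Function using (_∘_; mk↔ₛ′)
open import Function.Bundles using (mk⇔; _↔_; Inverse; Equivalence)
open import Function.Construct.Symmetry using (↔-sym)
open import Level using (0ℓ)
open import Relation.Binary.PropositionalEquality
  using (_≢_; refl; sym; trans; cong; cong₂; subst; isEquivalence; module ≡-Reasoning)
open import Relation.Nullary using (¬_; Dec; yes; no; contradiction; ¬?; _×-dec_)
open import Relation.Nullary.Decidable
  using (dec-true; dec-false; decidable-stable; toWitness; _→-dec_; ⌊_⌋; isYes≗does)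

private variable
  n : ℕ
  A B V W : Set

-- Finite sums

∑ : List A → (A → ℕ) → ℕ
∑ xs φ = sum (map φ xs)

∑-cong : ∀ (xs : List A) {φ ψ : A → ℕ} → (∀ {x} → x ∈ xs → φ x ≡ ψ x) → ∑ xs φ ≡ ∑ xs ψ
∑-cong []       e = refl
∑-cong (x ∷ xs) e = cong₂ _+_ (e (here refl)) (∑-cong xs (e ∘ there))

∑-mono : ∀ (xs : List A) {φ ψ : A → ℕ} → (∀ {x} → x ∈ xs → φ x ≤ ψ x) → ∑ xs φ ≤ ∑ xs ψ
∑-mono []       e = z≤n
∑-mono (x ∷ xs) e = +-mono-≤ (e (here refl)) (∑-mono xs (e ∘ there))

∑-const : ∀ (xs : List A) c → ∑ xs (λ _ → c) ≡ length xs * c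
∑-const []       c = refl
∑-const (x ∷ xs) c = cong (c +_) (∑-const xs c)

∑-+ : ∀ (xs : List A) (φ ψ : A → ℕ) → ∑ xs (λ x → φ x + ψ x) ≡ ∑ xs φ + ∑ xs ψ
∑-+ []       φ ψ = refl
∑-+ (x ∷ xs) φ ψ = trans (cong (φ x + ψ x +_) (∑-+ xs φ ψ))
  (interchange +-commutativeSemigroup (φ x) (ψ x) (∑ xs φ) (∑ xs ψ))

∑-swap : ∀ (xs : List A) (ys : List B) (φ : A → B → ℕ) →
         ∑ xs (λ x → ∑ ys (φ x)) ≡ ∑ ys (λ y → ∑ xs (λ x → φ x y))
∑-swap []       ys φ = sym (trans (∑-const ys 0) (*-zeroʳ (length ys)))
∑-swap (x ∷ xs) ys φ = trans (cong (∑ ys (φ x) +_) (∑-swap xs ys φ)) (sym (∑-+ ys (φ x) _))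

∑-∘ : ∀ (xs : List A) (h : A → B) (φ : B → ℕ) → ∑ (map h xs) φ ≡ ∑ xs (φ ∘ h)
∑-∘ xs h φ = cong sum (sym (map-∘ xs))

∑-≤1 : ∀ (xs : List A) {φ : A → ℕ} → (∀ x → φ x ≤ 1) → ∑ xs φ ≤ length xs
∑-≤1 xs φ≤1 = ≤-trans (∑-mono xs (λ _ → φ≤1 _)) (≤-reflexive (trans (∑-const xs 1) (*-identityʳ _)))

-- All other terms contribute at most 1 each, so the total leaves at least 1 for the term at `x`.
-- This turns equality in an averaged bound into equality for every single permutation.
∑-saturated : ∀ (xs : List A) {φ : A → ℕ} → (∀ x → φ x ≤ 1) → length xs ≤ ∑ xs φ →
              ∀ {x} → x ∈ xs → φ x ≡ 1
∑-saturated (x ∷ xs) {φ} φ≤1 le (here refl) = ≤-antisym (φ≤1 x)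
  (+-cancelʳ-≤ (∑ xs φ) 1 (φ x) (≤-trans (s≤s (∑-≤1 xs φ≤1)) le))
∑-saturated (x ∷ xs) {φ} φ≤1 le (there i) = ∑-saturated xs φ≤1
  (+-cancelˡ-≤ 1 (length xs) (∑ xs φ) (≤-trans le (+-monoˡ-≤ (∑ xs φ) (φ≤1 x)))) i

term≤∑ : ∀ (xs : List A) (φ : A → ℕ) {x} → x ∈ xs → φ x ≤ ∑ xs φ
term≤∑ (x ∷ xs) φ (here refl) = m≤m+n (φ x) _
term≤∑ (x ∷ xs) φ (there i)   = ≤-trans (term≤∑ xs φ i) (m≤n+m _ (φ x))

-- Once one term equals 1, the pairwise exclusions force all later terms to be 0.
∑-≤1-disjoint : ∀ {xs : List A} {φ : A → ℕ} → (∀ x → φ x ≤ 1) →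
  AllPairs (λ x y → φ x ≡ 1 → φ y ≡ 1 → ⊥) xs → ∑ xs φ ≤ 1
∑-≤1-disjoint {xs = []} φ≤1 [] = z≤n
∑-≤1-disjoint {xs = x ∷ xs} {φ} φ≤1 (d ∷ ds) with φ x in eq | φ≤1 x
... | zero     | _ = ∑-≤1-disjoint φ≤1 ds
... | suc zero | _ = s≤s (≤-reflexive (trans (∑-cong xs vanish) (trans (∑-const xs 0) (*-zeroʳ (length xs)))))
  where
  vanish : ∀ {y} → y ∈ xs → φ y ≡ 0
  vanish {y} i with φ y in eq′ | φ≤1 y
  ... | zero     | _ = refl
  ... | suc zero | _ = ⊥-elim (All.lookup d i refl eq′)
  ... | suc (suc _) | s≤s ()
... | suc (suc _) | s≤s ()

-- Permutations are tabulated as pairs (π, π⁻¹) of vectors, for which propositional equality is extensional.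

Table : ℕ → Set
Table n = Vec (Fin n) n × Vec (Fin n) n

Valid : ∀ {n} → Table n → Set
Valid (u , v) = (∀ x → lookup u (lookup v x) ≡ x) × (∀ x → lookup v (lookup u x) ≡ x)

valid? : ∀ {n} (t : Table n) → Dec (Valid t)
valid? (u , v) = all? (λ x → lookup u (lookup v x) ≟ x) ×-dec all? (λ x → lookup v (lookup u x) ≟ x)

toPerm : ∀ {n} → Table n → Permutation′ n
toPerm t@(u , v) with valid? t
... | yes (p , q) = permutation (lookup u) (lookup v) p q
-- Default value for pairs of vectors that are not mutually inverse; `tables` contains none of
-- these.
... | no _        = idₚ

fromPerm : ∀ {n} → Permutation′ n → Table n
fromPerm π = Vec.tabulate (π ⟨$⟩ʳ_) , Vec.tabulate (π ⟨$⟩ˡ_)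

fromPerm-valid : ∀ {n} (π : Permutation′ n) → Valid (fromPerm π)
fromPerm-valid π = tabulated (π ⟨$⟩ʳ_) (π ⟨$⟩ˡ_) (inverseʳ π) , tabulated (π ⟨$⟩ˡ_) (π ⟨$⟩ʳ_) (inverseˡ π)
  where
  tabulated : ∀ {n} (f g : Fin n → Fin n) → (∀ {x} → f (g x) ≡ x) →
              ∀ x → lookup (Vec.tabulate f) (lookup (Vec.tabulate g) x) ≡ x
  tabulated f g fg x = trans (cong (lookup (Vec.tabulate f)) (lookup∘tabulate g x))
    (trans (lookup∘tabulate f (g x)) fg)

toPerm∘fromPerm : ∀ {n} (π : Permutation′ n) → toPerm (fromPerm π) ≈ₚ π
toPerm∘fromPerm π x with valid? (fromPerm π)
... | yes _ = lookup∘tabulate _ x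
... | no ¬v = contradiction (fromPerm-valid π) ¬v

fromPerm∘toPerm : ∀ {n} (t : Table n) → Valid t → fromPerm (toPerm t) ≡ t
fromPerm∘toPerm t@(u , v) val with valid? t
... | yes _ = cong₂ _,_ (tabulate∘lookup u) (tabulate∘lookup v)
... | no ¬v = contradiction val ¬v

flip-cong : ∀ {n} {π ρ : Permutation′ n} → π ≈ₚ ρ → flip π ≈ₚ flip ρ
flip-cong {π = π} {ρ} e x =
  trans (sym (inverseˡ ρ)) (cong (ρ ⟨$⟩ˡ_) (trans (sym (e (π ⟨$⟩ˡ x))) (inverseʳ π)))

fromPerm-cong : ∀ {n} {π ρ : Permutation′ n} → π ≈ₚ ρ → fromPerm π ≡ fromPerm ρ
fromPerm-cong {π = π} {ρ} e = cong₂ _,_ (tabulate-cong e) (tabulate-cong (flip-cong {π = π} {ρ} e))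

allVecs : ∀ n k → List (Vec (Fin n) k)
allVecs n zero    = [] ∷ []
allVecs n (suc k) = cartesianProductWith _∷_ (allFin n) (allVecs n k)

allVecs-unique : ∀ n k → Unique (allVecs n k)
allVecs-unique n zero    = [] ∷ []
allVecs-unique n (suc k) =
  Unique.cartesianProductWith⁺ _∷_ (λ { refl → refl , refl }) (Unique.allFin⁺ n) (allVecs-unique n k)

∈-allVecs : ∀ {n k} (v : Vec (Fin n) k) → v ∈ allVecs n k
∈-allVecs []      = here refl
∈-allVecs (x ∷ v) = ∈-cartesianProductWith⁺ _∷_ (∈-allFin x) (∈-allVecs v)

tables : ∀ n → List (Table n)
tables n = filter valid? (cartesianProduct (allVecs n n) (allVecs n n))

perms : ∀ n → List (Permutation′ n)
perms n = map toPerm (tables n)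

tables-unique : ∀ n → Unique (tables n)
tables-unique n = Unique.filter⁺ valid? (Unique.cartesianProduct⁺ (allVecs-unique n n) (allVecs-unique n n))

valid⇒∈tables : ∀ {n} {t : Table n} → Valid t → t ∈ tables n
valid⇒∈tables {t = u , v} = ∈-filter⁺ valid? (∈-cartesianProduct⁺ (∈-allVecs u) (∈-allVecs v))

∈tables⇒valid : ∀ {n} {t : Table n} → t ∈ tables n → Valid t
∈tables⇒valid {n} i = proj₂ (∈-filter⁻ valid? {xs = cartesianProduct (allVecs n n) (allVecs n n)} i)

∈-perms : ∀ {n} (π : Permutation′ n) → ∃[ ρ ] (ρ ∈ perms n × ρ ≈ₚ π)
∈-perms π = toPerm (fromPerm π) , ∈-map⁺ toPerm (valid⇒∈tables (fromPerm-valid π)) , toPerm∘fromPerm π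

translate : ∀ {n} → Permutation′ n → Permutation′ n → Table n → Table n
translate α β t = fromPerm (α ∘ₚ toPerm t ∘ₚ β)

translate-inverse : ∀ {n} (α β : Permutation′ n) (t : Table n) → Valid t →
                    translate (flip α) (flip β) (translate α β t) ≡ t
translate-inverse α β t v = trans
  (fromPerm-cong {π = flip α ∘ₚ toPerm (translate α β t) ∘ₚ flip β} {ρ = toPerm t} λ x → trans
    (cong (β ⟨$⟩ˡ_) (trans (toPerm∘fromPerm (α ∘ₚ toPerm t ∘ₚ β) _)
      (cong (λ y → β ⟨$⟩ʳ (toPerm t ⟨$⟩ʳ y)) (inverseʳ α))))
    (inverseˡ β))
  (fromPerm∘toPerm t v)

-- Translation by the inverses undoes `translate α β`, so it maps `tables n` injectively onto
-- itself. Two duplicate-free lists with the same members are permutations of each other and have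
-- the same sum.
∑-tables-translate : ∀ {n} (α β : Permutation′ n) (φ : Table n → ℕ) →
                     ∑ (tables n) (φ ∘ translate α β) ≡ ∑ (tables n) φ
∑-tables-translate {n} α β φ = trans (sym (∑-∘ (tables n) (translate α β) φ))
  (sum-↭ (Perm.map⁺ φ (∼bag⇒↭ (unique∧set⇒bag unique (tables-unique n) (mk⇔ to from)))))
  where
  unique : Unique (map (translate α β) (tables n))
  unique = unique′ (tables n) (λ i → i) (tables-unique n)
    where
    unique′ : ∀ ts → (∀ {t} → t ∈ ts → t ∈ tables n) → Unique ts → Unique (map (translate α β) ts)
    unique′ [] _ [] = []
    unique′ (t ∷ ts) ⊆ (t∉ ∷ u) = All.tabulate fresh ∷ unique′ ts (⊆ ∘ there) u
      where
      fresh : ∀ {s} → s ∈ map (translate α β) ts → translate α β t ≢ s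
      fresh i e with t′ , t′∈ , refl ← ∈-map⁻ (translate α β) i = All.lookup t∉ t′∈
        (trans (sym (translate-inverse α β t (∈tables⇒valid (⊆ (here refl)))))
          (trans (cong (translate (flip α) (flip β)) e)
            (translate-inverse α β t′ (∈tables⇒valid (⊆ (there t′∈))))))
  to : ∀ {t} → t ∈ map (translate α β) (tables n) → t ∈ tables n
  to i with t′ , _ , refl ← ∈-map⁻ (translate α β) i = valid⇒∈tables (fromPerm-valid (α ∘ₚ toPerm t′ ∘ₚ β))
  from : ∀ {t} → t ∈ tables n → t ∈ map (translate α β) (tables n)
  from {t} i = subst (_∈ map (translate α β) (tables n))
    (translate-inverse (flip α) (flip β) t (∈tables⇒valid i))
    (∈-map⁺ (translate α β) (valid⇒∈tables (fromPerm-valid (flip α ∘ₚ toPerm t ∘ₚ flip β))))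

-- Permutations with the same underlying functions need not be propositionally equal, hence the
-- congruence hypothesis on `φ`; the reindexing itself happens on tables.
∑-perms-translate : ∀ {n} (α β : Permutation′ n) (φ : Permutation′ n → ℕ) →
  (∀ {π ρ} → π ≈ₚ ρ → φ π ≡ φ ρ) → ∑ (perms n) (λ π → φ (α ∘ₚ π ∘ₚ β)) ≡ ∑ (perms n) φ
∑-perms-translate {n} α β φ φ-cong = begin
  ∑ (perms n) (λ π → φ (α ∘ₚ π ∘ₚ β))           ≡⟨ ∑-∘ (tables n) toPerm _ ⟩
  ∑ (tables n) (λ t → φ (α ∘ₚ toPerm t ∘ₚ β))   ≡⟨ ∑-cong (tables n) (λ _ → φ-cong
                                                        (λ x → sym (toPerm∘fromPerm (α ∘ₚ toPerm _ ∘ₚ β) x))) ⟩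
  ∑ (tables n) (φ ∘ toPerm ∘ translate α β)     ≡⟨ ∑-tables-translate α β (φ ∘ toPerm) ⟩
  ∑ (tables n) (φ ∘ toPerm)                     ≡⟨ ∑-∘ (tables n) toPerm φ ⟨
  ∑ (perms n) φ                                 ∎
  where open ≡-Reasoning

-- Perfect matchings and their conjugates

transpose-left : ∀ (i j : Fin n) → transpose i j ⟨$⟩ʳ i ≡ j
transpose-left i j rewrite dec-true (i ≟ i) refl = refl

transpose-right : ∀ (i j : Fin n) → transpose i j ⟨$⟩ʳ j ≡ i
transpose-right i j with j ≟ i
... | yes j≡i = j≡i
... | no _ rewrite dec-true (j ≟ j) refl = refl

transpose-other : ∀ {i j k : Fin n} → k ≢ i → k ≢ j → transpose i j ⟨$⟩ʳ k ≡ k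
transpose-other {i = i} {j} {k} k≢i k≢j rewrite dec-false (k ≟ i) k≢i | dec-false (k ≟ j) k≢j = refl

to⇒from : ∀ (π : V ↔ W) {x y} → Inverse.to π x ≡ y → Inverse.from π y ≡ x
to⇒from π e = Inverse.inverseʳ π (sym e)

to-injective : ∀ (π : V ↔ W) {x y} → Inverse.to π x ≡ Inverse.to π y → x ≡ y
to-injective π e = trans (sym (to⇒from π e)) (to⇒from π refl)

from-injective : ∀ (π : V ↔ W) {x y} → Inverse.from π x ≡ Inverse.from π y → x ≡ y
from-injective π e = trans (sym (Inverse.inverseˡ π refl)) (Inverse.inverseˡ π e)

transpose-natural : ∀ (π : Permutation′ n) i j x →
  π ⟨$⟩ʳ (transpose i j ⟨$⟩ʳ x) ≡ transpose (π ⟨$⟩ʳ i) (π ⟨$⟩ʳ j) ⟨$⟩ʳ (π ⟨$⟩ʳ x)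
transpose-natural π i j x = by-cases (x ≟ i) (x ≟ j)
  where
  by-cases : Dec (x ≡ i) → Dec (x ≡ j) →
    π ⟨$⟩ʳ (transpose i j ⟨$⟩ʳ x) ≡ transpose (π ⟨$⟩ʳ i) (π ⟨$⟩ʳ j) ⟨$⟩ʳ (π ⟨$⟩ʳ x)
  by-cases (yes refl) _ = trans (cong (π ⟨$⟩ʳ_) (transpose-left x j)) (sym (transpose-left (π ⟨$⟩ʳ i) (π ⟨$⟩ʳ j)))
  by-cases (no _) (yes refl) = trans (cong (π ⟨$⟩ʳ_) (transpose-right i x))
    (sym (transpose-right (π ⟨$⟩ʳ i) (π ⟨$⟩ʳ j)))
  by-cases (no x≢i) (no x≢j) = trans (cong (π ⟨$⟩ʳ_) (transpose-other x≢i x≢j))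
                          (sym (transpose-other (x≢i ∘ to-injective π) (x≢j ∘ to-injective π)))

-- Whenever P x ≢ Q x, conjugating P by the transposition of P x and Q x creates an agreement at x
-- and moves no point where P and Q already agree.
conjugating : ∀ (P Q : Fin n → Fin n) → (∀ x → P (P x) ≡ x) → (∀ x → Q (Q x) ≡ x) →
  (∀ x → P x ≡ Q x ⊎ (P x ≢ x × Q x ≢ x)) →
  ∃[ π ] ((∀ x → π ⟨$⟩ʳ P x ≡ Q (π ⟨$⟩ʳ x)) × (∀ x → P x ≡ Q x → π ⟨$⟩ʳ x ≡ x))
conjugating {n} P₀ Q P₀² Q² fix₀ = go (allFin n) P₀ P₀² fix₀ (λ x → inj₁ (∈-allFin x))
  where
  -- Invariant: `P` and `Q` agree at every point outside `xs`, so at the end of the list they agree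
  -- everywhere and the identity works.
  go : ∀ xs P → (∀ x → P (P x) ≡ x) → (∀ x → P x ≡ Q x ⊎ (P x ≢ x × Q x ≢ x)) →
       (∀ x → x ∈ xs ⊎ P x ≡ Q x) →
       ∃[ π ] ((∀ x → π ⟨$⟩ʳ P x ≡ Q (π ⟨$⟩ʳ x)) × (∀ x → P x ≡ Q x → π ⟨$⟩ʳ x ≡ x))
  go [] P P² fix rem = idₚ , agree , λ _ _ → refl
    where
    agree : ∀ x → P x ≡ Q x
    agree x with rem x
    ... | inj₂ e = e
  go (x ∷ xs) P P² fix rem with P x ≟ Q x | fix x
  ... | yes e | _ = go xs P P² fix rem′
    where
    rem′ : ∀ y → y ∈ xs ⊎ P y ≡ Q y
    rem′ y with rem y
    ... | inj₁ (here refl) = inj₂ e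
    ... | inj₁ (there i)   = inj₁ i
    ... | inj₂ e′          = inj₂ e′
  ... | no Px≢Qx | inj₁ e = contradiction e Px≢Qx
  ... | no Px≢Qx | inj₂ (Px≢x , Qx≢x) =
    τ ∘ₚ π , (λ y → trans (cong (π ⟨$⟩ʳ_) (sym (P′τ y))) (intertwines (τ ⟨$⟩ʳ y))) ,
    λ y e → trans (cong (π ⟨$⟩ʳ_) (τ-fixes y e)) (fixes y (agree y e))
    where
    τ = transpose (P x) (Q x)
    P′ : Fin n → Fin n
    P′ y = τ ⟨$⟩ʳ P (τ ⟨$⟩ˡ y)
    P′τ : ∀ y → P′ (τ ⟨$⟩ʳ y) ≡ τ ⟨$⟩ʳ P y
    P′τ y = cong (λ z → τ ⟨$⟩ʳ P z) (inverseˡ τ)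
    P′² : ∀ y → P′ (P′ y) ≡ y
    P′² y = trans (P′τ _) (trans (cong (τ ⟨$⟩ʳ_) (P² _)) (inverseʳ τ))
    -- A point of agreement is neither `P x` nor `Q x`: otherwise its common image would be `x`,
    -- forcing `P x ≡ Q x`.
    τ-fixes : ∀ y → P y ≡ Q y → τ ⟨$⟩ʳ y ≡ y
    τ-fixes y e = transpose-other
      (λ { refl → Px≢Qx (trans (sym (Q² (P x))) (cong Q (trans (sym e) (P² x)))) })
      (λ { refl → Px≢Qx (trans (cong P (sym (trans e (Q² x)))) (P² (Q x))) })
    agree : ∀ y → P y ≡ Q y → P′ y ≡ Q y
    agree y e = begin
      P′ y                 ≡⟨ cong P′ (τ-fixes y e) ⟨
      P′ (τ ⟨$⟩ʳ y)        ≡⟨ P′τ y ⟩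
      τ ⟨$⟩ʳ P y           ≡⟨ τ-fixes (P y) (trans (P² y) (trans (sym (Q² y)) (cong Q (sym e)))) ⟩
      P y                  ≡⟨ e ⟩
      Q y                  ∎
      where open ≡-Reasoning
    agree-x : P′ x ≡ Q x
    agree-x = trans (cong P′ (sym (transpose-other (Px≢x ∘ sym) (Qx≢x ∘ sym))))
      (trans (P′τ x) (transpose-left (P x) (Q x)))
    fix′ : ∀ y → P′ y ≡ Q y ⊎ (P′ y ≢ y × Q y ≢ y)
    fix′ y with fix y
    ... | inj₁ e = inj₁ (agree y e)
    ... | inj₂ (_ , Qy≢y) = inj₂ (P′y≢y , Qy≢y)
      where
      P′y≢y : P′ y ≢ y
      P′y≢y e with fix (τ ⟨$⟩ˡ y) | to-injective τ (trans e (sym (inverseʳ τ)))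
      ... | inj₂ (Pz≢z , _) | Pz≡z = Pz≢z Pz≡z
      ... | inj₁ Pz≡Qz | Pz≡z = Qy≢y (subst (λ z → Q z ≡ z)
              (trans (sym (τ-fixes _ Pz≡Qz)) (inverseʳ τ)) (trans (sym Pz≡Qz) Pz≡z))
    rem′ : ∀ y → y ∈ xs ⊎ P′ y ≡ Q y
    rem′ y with rem y
    ... | inj₁ (here refl) = inj₂ agree-x
    ... | inj₁ (there i)   = inj₁ i
    ... | inj₂ e           = inj₂ (agree y e)
    ih = go xs P′ P′² fix′ rem′
    π = proj₁ ih
    intertwines = proj₁ (proj₂ ih)
    fixes = proj₂ (proj₂ ih)

record Matching (V : Set) : Set where
  no-eta-equality
  field
    mate       : V → V
    involutive : ∀ x → mate (mate x) ≡ x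
    fixfree    : ∀ x → mate x ≢ x

  mate-injective : ∀ {x y} → mate x ≡ mate y → x ≡ y
  mate-injective {x} {y} e = trans (sym (involutive x)) (trans (cong mate e) (involutive y))

  mate-flip : ∀ {x y} → mate x ≡ y → mate y ≡ x
  mate-flip {x} e = trans (cong mate (sym e)) (involutive x)

open Matching public

infix 4 _≈_

_≈_ : Matching V → Matching V → Set
M ≈ N = ∀ x → mate M x ≡ mate N x

Meets : Matching V → Matching V → Set
Meets M N = ∃[ x ] mate M x ≡ mate N x

Disjoint : Matching V → Matching V → Set
Disjoint M N = ∀ x → mate M x ≢ mate N x

_≈?_ : (M N : Matching (Fin n)) → Dec (M ≈ N)
M ≈? N = all? (λ x → mate M x ≟ mate N x)

conj : V ↔ W → Matching V → Matching W
conj π M .mate x = Inverse.to π (mate M (Inverse.from π x))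
conj π M .involutive x =
  trans (cong (Inverse.to π ∘ mate M) (to⇒from π refl))
    (trans (cong (Inverse.to π) (involutive M _)) (Inverse.inverseˡ π refl))
conj π M .fixfree x e = fixfree M _ (sym (to⇒from π e))

conj-mate : ∀ (π : V ↔ W) M x → mate (conj π M) (Inverse.to π x) ≡ Inverse.to π (mate M x)
conj-mate π M x = cong (Inverse.to π ∘ mate M) (to⇒from π refl)

conj-cong : ∀ (π : V ↔ W) {M N} → M ≈ N → conj π M ≈ conj π N
conj-cong π e x = cong (Inverse.to π) (e _)

conj-congˡ : ∀ {π ρ : Permutation′ n} M → π ≈ₚ ρ → conj π M ≈ conj ρ M
conj-congˡ {π = π} {ρ} M e x = trans (e _) (cong (λ y → ρ ⟨$⟩ʳ mate M y) (flip-cong {π = π} {ρ} e x))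

conj-disjoint : ∀ (π : V ↔ W) {M N} → Disjoint M N → Disjoint (conj π M) (conj π N)
conj-disjoint π d x e = d _ (to-injective π e)

intertwining⇒conj≈ : ∀ (π : V ↔ W) M N → (∀ x → Inverse.to π (mate M x) ≡ mate N (Inverse.to π x)) → conj π M ≈ N
intertwining⇒conj≈ π M N e x = trans (e _) (cong (mate N) (Inverse.inverseˡ π refl))

conj-transpose : ∀ (π : Permutation′ n) i j M →
  conj π (conj (transpose i j) M) ≈ conj (transpose (π ⟨$⟩ʳ i) (π ⟨$⟩ʳ j)) (conj π M)
conj-transpose π i j M =
  conj-congˡ {π = transpose i j ∘ₚ π} {π ∘ₚ transpose (π ⟨$⟩ʳ i) (π ⟨$⟩ʳ j)} M (transpose-natural π i j)

transpose-edge-commutes : ∀ (M : Matching (Fin n)) {x y} → mate M x ≡ y →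
  ∀ z → transpose x y ⟨$⟩ʳ mate M z ≡ mate M (transpose x y ⟨$⟩ʳ z)
transpose-edge-commutes M {x} {y} e z = by-cases (z ≟ x) (z ≟ y)
  where
  by-cases : Dec (z ≡ x) → Dec (z ≡ y) →
    transpose x y ⟨$⟩ʳ mate M z ≡ mate M (transpose x y ⟨$⟩ʳ z)
  by-cases (yes refl) _ = trans (trans (cong (transpose x y ⟨$⟩ʳ_) e) (transpose-right x y))
                      (sym (trans (cong (mate M) (transpose-left x y)) (mate-flip M e)))
  by-cases (no _) (yes refl) = trans (trans (cong (transpose x y ⟨$⟩ʳ_) (mate-flip M e)) (transpose-left x y))
                      (sym (trans (cong (mate M) (transpose-right x y)) e))
  by-cases (no z≢x) (no z≢y) = trans
    (transpose-other (λ e′ → z≢y (mate-injective M (trans e′ (sym (mate-flip M e)))))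
      (λ e′ → z≢x (mate-injective M (trans e′ (sym e)))))
    (cong (mate M) (sym (transpose-other z≢x z≢y)))

conj-transpose-edge : ∀ (M : Matching (Fin n)) {x y} → mate M x ≡ y → conj (transpose x y) M ≈ M
conj-transpose-edge M {x} {y} e = intertwining⇒conj≈ (transpose x y) M M (transpose-edge-commutes M e)

-- An automorphism of `M` moving only the edges at `x` and `y`: the identity if the points coincide,
-- the swap of the two ends if they form an edge, and otherwise the swap of `x` with `y` together
-- with the swap of their mates.
edge-exchange : ∀ (M : Matching (Fin n)) x y →
  ∃[ π ] ((∀ z → π ⟨$⟩ʳ mate M z ≡ mate M (π ⟨$⟩ʳ z)) × π ⟨$⟩ʳ x ≡ y ×
          (∀ {z} → z ≢ x → mate M z ≢ x → z ≢ y → mate M z ≢ y → π ⟨$⟩ʳ z ≡ z))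
edge-exchange M x y with x ≟ y | mate M x ≟ y
... | yes e | _     = idₚ , (λ _ → refl) , e , λ _ _ _ _ → refl
... | no _  | yes e = transpose x y , transpose-edge-commutes M e , transpose-left x y ,
                      λ z≢x _ z≢y _ → transpose-other z≢x z≢y
... | no x≢y | no Mx≢y = π , commutes , πx , λ z≢x Mz≢x z≢y Mz≢y → πz z≢x Mz≢x z≢y Mz≢y
  where
  x′ = mate M x
  y′ = mate M y
  π = transpose x y ∘ₚ transpose x′ y′
  y≢y′ : y ≢ y′
  y≢y′ e = fixfree M y (sym e)
  x≢x′ : x ≢ x′
  x≢x′ e = fixfree M x (sym e)
  x≢y′ : x ≢ y′
  x≢y′ e = Mx≢y (mate-flip M (sym e))
  πx : π ⟨$⟩ʳ x ≡ y
  πx = trans (cong (transpose x′ y′ ⟨$⟩ʳ_) (transpose-left x y)) (transpose-other (Mx≢y ∘ sym) y≢y′)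
  πy : π ⟨$⟩ʳ y ≡ x
  πy = trans (cong (transpose x′ y′ ⟨$⟩ʳ_) (transpose-right x y)) (transpose-other x≢x′ x≢y′)
  πx′ : π ⟨$⟩ʳ x′ ≡ y′
  πx′ = trans (cong (transpose x′ y′ ⟨$⟩ʳ_) (transpose-other (x≢x′ ∘ sym) Mx≢y)) (transpose-left x′ y′)
  πy′ : π ⟨$⟩ʳ y′ ≡ x′
  πy′ = trans (cong (transpose x′ y′ ⟨$⟩ʳ_) (transpose-other (x≢y′ ∘ sym) (y≢y′ ∘ sym))) (transpose-right x′ y′)
  πz : ∀ {z} → z ≢ x → mate M z ≢ x → z ≢ y → mate M z ≢ y → π ⟨$⟩ʳ z ≡ z
  πz z≢x Mz≢x z≢y Mz≢y = trans (cong (transpose x′ y′ ⟨$⟩ʳ_) (transpose-other z≢x z≢y))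
    (transpose-other (λ e → Mz≢x (mate-flip M (sym e))) (λ e → Mz≢y (mate-flip M (sym e))))
  commutes : ∀ z → π ⟨$⟩ʳ mate M z ≡ mate M (π ⟨$⟩ʳ z)
  commutes z = by-cases (z ≟ x) (mate M z ≟ x) (z ≟ y) (mate M z ≟ y)
    where
    by-cases : Dec (z ≡ x) → Dec (mate M z ≡ x) → Dec (z ≡ y) → Dec (mate M z ≡ y) →
      π ⟨$⟩ʳ mate M z ≡ mate M (π ⟨$⟩ʳ z)
    by-cases (yes refl) _ _ _ = trans πx′ (cong (mate M) (sym πx))
    by-cases (no _) (yes e) _ _ with refl ← mate-flip M e =
      trans (cong (π ⟨$⟩ʳ_) e) (trans πx (sym (trans (cong (mate M) πx′) (involutive M y))))
    by-cases (no _) (no _) (yes refl) _ = trans πy′ (cong (mate M) (sym πy))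
    by-cases (no _) (no _) (no _) (yes e) with refl ← mate-flip M e =
      trans (cong (π ⟨$⟩ʳ_) e) (trans πy (sym (trans (cong (mate M) πy′) (involutive M x))))
    by-cases (no z≢x) (no Mz≢x) (no z≢y) (no Mz≢y) =
      trans (πz Mz≢x (λ e → z≢x (trans (sym (involutive M z)) e)) Mz≢y (λ e → z≢y (trans (sym (involutive M z)) e)))
        (cong (mate M) (sym (πz z≢x Mz≢x z≢y Mz≢y)))

transitive : ∀ (M N : Matching (Fin n)) → ∃[ π ] conj π M ≈ N
transitive M N
  with π , e , _ ← conjugating (mate M) (mate N) (involutive M) (involutive N)
                     (λ x → inj₂ (fixfree M x , fixfree N x))
  = π , intertwining⇒conj≈ π M N e

OnDistinctEdges : Matching (Fin n) → Fin n → Fin n → Set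
OnDistinctEdges M x y = x ≢ y × mate M x ≢ y

-- The marks are placed one at a time: after a permutation handles the later marks, `edge-exchange`
-- on `N` puts the first one in place and leaves the others alone, since they lie on other edges.
transitive-marked : ∀ (M N : Matching (Fin n)) (ps : List (Fin n × Fin n)) →
  AllPairs (λ p q → OnDistinctEdges M (proj₁ p) (proj₁ q) × OnDistinctEdges N (proj₂ p) (proj₂ q)) ps →
  ∃[ π ] (conj π M ≈ N × All (λ p → π ⟨$⟩ʳ proj₁ p ≡ proj₂ p) ps)
transitive-marked M N [] [] with π , e ← transitive M N = π , e , []
transitive-marked {n} M N ((x , y) ∷ ps) (d ∷ ds) with transitive-marked M N ps ds
... | π , e , marks with edge-exchange N (π ⟨$⟩ʳ x) y
...   | ρ , commutes , moves , fixes =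
  π ∘ₚ ρ , (λ z → trans (conj-cong ρ {conj π M} {N} e z) (intertwining⇒conj≈ ρ N N commutes z)) ,
  moves ∷ All.tabulate fixed
  where
  mate-N : ∀ z → mate N (π ⟨$⟩ʳ z) ≡ π ⟨$⟩ʳ mate M z
  mate-N z = trans (sym (e (π ⟨$⟩ʳ z))) (conj-mate π M z)
  fixed : ∀ {p} → p ∈ ps → ρ ⟨$⟩ʳ (π ⟨$⟩ʳ proj₁ p) ≡ proj₂ p
  fixed {p} i with All.lookup d i | All.lookup marks i
  ... | (x≢p , Mx≢p) , (y≢p , Ny≢p) | refl = fixes
    (λ e′ → x≢p (to-injective π (sym e′)))
    (λ e′ → Mx≢p (mate-flip M (to-injective π (trans (sym (mate-N _)) e′))))
    (λ e′ → y≢p (sym e′))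
    (λ e′ → Ny≢p (mate-flip N e′))

-- The clique–coclique bound

[_] : {P : Set} → Dec P → ℕ
[ yes _ ] = 1
[ no _ ]  = 0

[]-yes : ∀ {P : Set} (p? : Dec P) → P → [ p? ] ≡ 1
[]-yes (yes _) _ = refl
[]-yes (no ¬p) p = contradiction p ¬p

[]≤1 : ∀ {P : Set} (p? : Dec P) → [ p? ] ≤ 1
[]≤1 (yes _) = s≤s z≤n
[]≤1 (no _)  = z≤n

[]-cong : ∀ {P Q : Set} (p? : Dec P) (q? : Dec Q) → (P → Q) → (Q → P) → [ p? ] ≡ [ q? ]
[]-cong (yes p) (yes q) _ _ = refl
[]-cong (no ¬p) (no ¬q) _ _ = refl
[]-cong (yes p) (no ¬q) f _ = contradiction (f p) ¬q
[]-cong (no ¬p) (yes q) _ g = contradiction (g q) ¬p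

-- Recursive, so that `Fin (double (suc m))` unfolds to two new points in front of `Fin (double m)`,
-- as `cap` needs.
double : ℕ → ℕ
double zero    = zero
double (suc m) = suc (suc (double m))

suc² : Fin n → Fin (suc (suc n))
suc² x = suc (suc x)

cap : Matching (Fin n) → Matching (Fin (suc (suc n)))
cap M .mate zero          = suc zero
cap M .mate (suc zero)    = zero
cap M .mate (suc (suc x)) = suc (suc (mate M x))
cap M .involutive zero          = refl
cap M .involutive (suc zero)    = refl
cap M .involutive (suc (suc x)) = cong suc² (involutive M x)
cap M .fixfree zero          ()
cap M .fixfree (suc zero)    ()
cap M .fixfree (suc (suc x)) e = fixfree M x (Fin.suc-injective (Fin.suc-injective e))

cap-surjective : ∀ (M : Matching (Fin (suc (suc n)))) → mate M zero ≡ suc zero → ∃[ N ] cap N ≈ M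
cap-surjective {n} M M0≡1 = N , λ
  { zero → sym M0≡1 ; (suc zero) → sym (mate-flip M M0≡1) ; (suc (suc x)) → sym (proj₂ (inner x)) }
  where
  inner : ∀ x → ∃[ y ] mate M (suc (suc x)) ≡ suc (suc y)
  inner x with mate M (suc (suc x)) in e
  ... | zero        = contradiction (trans (sym (mate-flip M e)) M0≡1) λ ()
  ... | suc zero    = contradiction (trans (sym (mate-flip M e)) (mate-flip M M0≡1)) λ ()
  ... | suc (suc y) = y , refl
  N : Matching (Fin n)
  N .mate x = proj₁ (inner x)
  N .involutive x = Fin.suc-injective (Fin.suc-injective (trans (sym (proj₂ (inner _)))
    (mate-flip M (proj₂ (inner x)))))
  N .fixfree x e = fixfree M (suc (suc x)) (trans (proj₂ (inner x)) (cong suc² e))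

cap-cong : {M N : Matching (Fin n)} → M ≈ N → cap M ≈ cap N
cap-cong e zero          = refl
cap-cong e (suc zero)    = refl
cap-cong e (suc (suc x)) = cong suc² (e x)

standard : ∀ m → Matching (Fin (double m))
standard zero    = record { mate = λ x → x ; involutive = λ _ → refl ; fixfree = λ () }
standard (suc m) = cap (standard m)

swap : Fin (suc n) → Permutation′ (suc (suc n))
swap j = transpose (suc zero) (suc j)

length-cartesianProductWith : ∀ {A B C : Set} (f : A → B → C) xs ys →
                              length (cartesianProductWith f xs ys) ≡ length xs * length ys
length-cartesianProductWith f []       ys = refl
length-cartesianProductWith f (x ∷ xs) ys =
  trans (length-++ (map (f x) ys)) (cong₂ _+_ (length-map (f x) ys) (length-cartesianProductWith f xs ys))

-- `cap` pairs 0 with 1, and conjugation by `swap j` carries 1 to `suc j`, so `j` chooses the mate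
-- of 0. The 2m + 1 choices give the double factorial.
matchings : ∀ m → List (Matching (Fin (double m)))
matchings zero    = standard zero ∷ []
matchings (suc m) = cartesianProductWith (λ j M → conj (swap j) (cap M))
                      (allFin (suc (double m))) (matchings m)

length-matchings : ∀ m → length (matchings (suc m)) ≡ suc (double m) !!
length-matchings m = trans (length-cartesianProductWith _ (allFin (suc (double m))) (matchings m))
  (trans (cong (_* length (matchings m)) (length-tabulate {n = suc (double m)} (λ x → x))) (step m))
  where
  step : ∀ m → suc (double m) * length (matchings m) ≡ suc (double m) !!
  step zero    = refl
  step (suc m) = cong (suc (double (suc m)) *_) (length-matchings m)

matchings-complete : ∀ m (M : Matching (Fin (double m))) → ∃[ N ] (N ∈ matchings m × M ≈ N)
matchings-complete zero    M = _ , here refl , λ ()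
matchings-complete (suc m) M with mate M zero in e
... | zero  = contradiction e (fixfree M zero)
... | suc j
  with N , capN≈ ← cap-surjective (conj (flip (swap j)) M)
         (trans (cong (swap j ⟨$⟩ˡ_) e) (to⇒from (swap j) (transpose-left (suc zero) (suc j))))
  with N′ , N′∈ , N≈N′ ← matchings-complete m N
  = conj τ (cap N′) , ∈-cartesianProductWith⁺ _ (∈-allFin j) N′∈ , λ x → begin
      mate M x                               ≡⟨ cong (mate M) (inverseʳ τ) ⟨
      mate M (τ ⟨$⟩ʳ (τ ⟨$⟩ˡ x))             ≡⟨ inverseʳ τ ⟨
      mate (conj τ (conj (flip τ) M)) x      ≡⟨ conj-cong τ {cap N′} {conj (flip τ) M}
                                                  (λ y → trans (sym (cap-cong N≈N′ y)) (capN≈ y)) x ⟨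
      mate (conj τ (cap N′)) x               ∎
  where
  open ≡-Reasoning
  τ = swap j

count : List (Matching (Fin n)) → Matching (Fin n) → ℕ
count Fs M = ∑ Fs (λ Q → [ M ≈? Q ])

count-cong : ∀ (Fs : List (Matching (Fin n))) {M N} → M ≈ N → count Fs M ≡ count Fs N
count-cong Fs {M} {N} e = ∑-cong Fs λ {Q} _ →
  []-cong (M ≈? Q) (N ≈? Q) (λ e′ x → trans (sym (e x)) (e′ x)) (λ e′ x → trans (e x) (e′ x))

count-positive⇒∈ : ∀ (Fs : List (Matching (Fin n))) {M} → 1 ≤ count Fs M → ∃[ Q ] (Q ∈ Fs × M ≈ Q)
count-positive⇒∈ (Q ∷ Fs) {M} le with M ≈? Q
... | yes e = Q , here refl , e
... | no _ with Q′ , i , e ← count-positive⇒∈ Fs {M} le = Q′ , there i , e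

Distinct : List (Matching (Fin n)) → Set
Distinct = AllPairs (λ M N → ¬ M ≈ N)

count≤1 : ∀ {Fs : List (Matching (Fin n))} → Distinct Fs → ∀ M → count Fs M ≤ 1
count≤1 {Fs = Fs} d M = ∑-≤1-disjoint (λ Q → []≤1 (M ≈? Q)) (AllPairs.map (λ {P} {Q} → both {P} {Q}) d)
  where
  both : ∀ {P Q} → ¬ P ≈ Q → [ M ≈? P ] ≡ 1 → [ M ≈? Q ] ≡ 1 → ⊥
  both {P} {Q} P≉Q _ _ with M ≈? P | M ≈? Q
  ... | yes e | yes e′ = P≉Q (λ x → trans (sym (e x)) (e′ x))

∈⇒count≡1 : ∀ {Fs : List (Matching (Fin n))} → Distinct Fs → ∀ {M Q} → Q ∈ Fs → M ≈ Q → count Fs M ≡ 1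
∈⇒count≡1 {Fs = Fs} d {M} {Q} i e = ≤-antisym (count≤1 d M)
  (≤-trans (≤-reflexive (sym ([]-yes (M ≈? Q) e))) (term≤∑ Fs _ i))

-- Averaging over all permutations.

hits : Matching (Fin n) → Matching (Fin n) → ℕ
hits {n} P Q = ∑ (perms n) (λ π → [ conj π P ≈? Q ])

-- If `α` carries `P` to `P′` and `β` carries `Q′` to `Q`, then `π` carries `P′` to `Q′` exactly
-- when `α ∘ₚ π ∘ₚ β` carries `P` to `Q`.
hits-constant : ∀ (P Q P′ Q′ : Matching (Fin n)) → hits P Q ≡ hits P′ Q′
hits-constant {n} P Q P′ Q′ with α , αP≈P′ ← transitive P P′ | β , βQ′≈Q ← transitive Q′ Q = begin
  hits P Q
    ≡⟨ ∑-perms-translate α β (λ π → [ conj π P ≈? Q ]) (λ {π} {ρ} e → []-cong (conj π P ≈? Q) (conj ρ P ≈? Q)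
         (λ e′ x → trans (sym (conj-congˡ {π = π} {ρ} P e x)) (e′ x))
         (λ e′ x → trans (conj-congˡ {π = π} {ρ} P e x) (e′ x))) ⟨
  ∑ (perms n) (λ π → [ conj (α ∘ₚ π ∘ₚ β) P ≈? Q ])
    ≡⟨ ∑-cong (perms n) (λ {π} _ → []-cong (conj (α ∘ₚ π ∘ₚ β) P ≈? Q) (conj π P′ ≈? Q′)
         (λ e x → to-injective β (trans (sym (moved π x)) (trans (e _) (target x))))
         (λ e x → trans (cong (λ y → mate (conj (α ∘ₚ π ∘ₚ β) P) y) (sym (inverseʳ β)))
           (trans (moved π _) (trans (cong (β ⟨$⟩ʳ_) (e _))
             (trans (sym (target _)) (cong (mate Q) (inverseʳ β))))))) ⟩
  hits P′ Q′ ∎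
  where
  open ≡-Reasoning
  moved : ∀ π x → mate (conj (α ∘ₚ π ∘ₚ β) P) (β ⟨$⟩ʳ x) ≡ β ⟨$⟩ʳ mate (conj π P′) x
  moved π x = trans (conj-mate β (conj π (conj α P)) x) (cong (β ⟨$⟩ʳ_) (conj-cong π {conj α P} {P′} αP≈P′ x))
  target : ∀ x → mate Q (β ⟨$⟩ʳ x) ≡ β ⟨$⟩ʳ mate Q′ x
  target x = trans (sym (βQ′≈Q _)) (conj-mate β Q′ x)

hits-positive : ∀ (P : Matching (Fin n)) → 1 ≤ hits P P
hits-positive {n} P with π , π∈ , π≈id ← ∈-perms (idₚ {n}) = ≤-trans
  (≤-reflexive (sym ([]-yes (conj π P ≈? P) (conj-congˡ {π = π} {idₚ} P π≈id))))
  (term≤∑ (perms n) (λ π → [ conj π P ≈? P ]) π∈)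

record Clique (n : ℕ) : Set where
  field
    members  : List (Matching (Fin n))
    disjoint : AllPairs Disjoint members

open Clique public

module _ {m : ℕ} (Fs : List (Matching (Fin (double (suc m))))) (distinct : Distinct Fs)
         (intersecting : ∀ {P Q} → P ∈ Fs → Q ∈ Fs → Meets P Q) where

  private
    N = double (suc m)
    P₀ : Matching (Fin N)
    P₀ = standard (suc m)
    -- The order of the stabilizer of a matching; by `hits-constant` also the number of permutations
    -- carrying any one matching to any other.
    c = hits P₀ P₀

  counts : Clique N → Permutation′ N → ℕ
  counts C π = ∑ (members C) (λ P → count Fs (conj π P))

  -- Two members of one translate of `C` are disjoint, whereas two members of the family share an
  -- edge.
  counts≤1 : ∀ C π → counts C π ≤ 1
  counts≤1 C π = ∑-≤1-disjoint (λ P → count≤1 distinct (conj π P))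
    (AllPairs.map (λ {P} {Q} → both {P} {Q}) (disjoint C))
    where
    both : ∀ {P Q} → Disjoint P Q → count Fs (conj π P) ≡ 1 → count Fs (conj π Q) ≡ 1 → ⊥
    both {P} {Q} d e e′
      with P′ , P′∈ , P≈ ← count-positive⇒∈ Fs {conj π P} (≤-reflexive (sym e))
         | Q′ , Q′∈ , Q≈ ← count-positive⇒∈ Fs {conj π Q} (≤-reflexive (sym e′))
      with x , meet ← intersecting P′∈ Q′∈
      = conj-disjoint π {P} {Q} d x (trans (P≈ x) (trans meet (sym (Q≈ x))))

  -- Double counting: each pair of a clique member and a family member is matched by exactly `c`
  -- permutations.
  ∑-counts : ∀ C → ∑ (perms N) (counts C) ≡ length (members C) * length Fs * c
  ∑-counts C = begin
    ∑ (perms N) (counts C)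
      ≡⟨ ∑-swap (perms N) (members C) _ ⟩
    ∑ (members C) (λ P → ∑ (perms N) (λ π → count Fs (conj π P)))
      ≡⟨ ∑-cong (members C) (λ {P} _ → trans (∑-swap (perms N) Fs _)
           (trans (∑-cong Fs (λ {Q} _ → hits-constant P Q P₀ P₀)) (∑-const Fs c))) ⟩
    ∑ (members C) (λ _ → length Fs * c)
      ≡⟨ ∑-const (members C) _ ⟩
    length (members C) * (length Fs * c)
      ≡⟨ *-assoc (length (members C)) (length Fs) c ⟨
    length (members C) * length Fs * c ∎
    where open ≡-Reasoning

  -- Every permutation carries `P₀` to some listed matching, and each listed matching is reached by
  -- `c` permutations.
  length-perms : length (perms N) ≤ suc (double m) !! * c
  length-perms = begin
    length (perms N)
      ≡⟨ *-identityʳ _ ⟨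
    length (perms N) * 1
      ≡⟨ ∑-const (perms N) 1 ⟨
    ∑ (perms N) (λ _ → 1)
      ≤⟨ ∑-mono (perms N) (λ {π} _ → hit π) ⟩
    ∑ (perms N) (λ π → ∑ (matchings (suc m)) (λ Q → [ conj π P₀ ≈? Q ]))
      ≡⟨ ∑-swap (perms N) (matchings (suc m)) _ ⟩
    ∑ (matchings (suc m)) (hits P₀)
      ≡⟨ ∑-cong (matchings (suc m)) (λ {Q} _ → hits-constant P₀ Q P₀ P₀) ⟩
    ∑ (matchings (suc m)) (λ _ → c)
      ≡⟨ ∑-const (matchings (suc m)) c ⟩
    length (matchings (suc m)) * c
      ≡⟨ cong (_* c) (length-matchings m) ⟩
    suc (double m) !! * c
      ∎
    where
    open ≤-Reasoning
    hit : ∀ π → 1 ≤ ∑ (matchings (suc m)) (λ Q → [ conj π P₀ ≈? Q ])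
    hit π with Q , Q∈ , e ← matchings-complete (suc m) (conj π P₀) =
      ≤-trans (≤-reflexive (sym ([]-yes (conj π P₀ ≈? Q) e))) (term≤∑ (matchings (suc m)) _ Q∈)

  clique-coclique : ∀ C → length (members C) * length Fs ≤ suc (double m) !!
  clique-coclique C = *-cancelʳ-≤ _ _ c {{>-nonZero (hits-positive P₀)}} (begin
    length (members C) * length Fs * c   ≡⟨ ∑-counts C ⟨
    ∑ (perms N) (counts C)               ≤⟨ ∑-≤1 (perms N) (counts≤1 C) ⟩
    length (perms N)                     ≤⟨ length-perms ⟩
    suc (double m) !! * c                ∎)
    where open ≤-Reasoning

  -- With equality, the sum of `counts C` reaches the number of permutations, so no term may fall
  -- below 1. An arbitrary `π` is first replaced by its representative in `perms`.
  clique-coclique-tight : ∀ C → suc (double m) !! ≤ length (members C) * length Fs → ∀ π → counts C π ≡ 1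
  clique-coclique-tight C tight π with ρ , ρ∈ , ρ≈π ← ∈-perms π = trans
    (∑-cong (members C) (λ {P} _ → count-cong Fs {conj π P} {conj ρ P} (λ x → sym (conj-congˡ {π = ρ} {π} P ρ≈π x))))
    (∑-saturated (perms N) (counts≤1 C)
      (≤-trans length-perms (≤-trans (*-monoˡ-≤ c tight) (≤-reflexive (sym (∑-counts C))))) ρ∈)

-- Second differences along disjoint transpositions

_∈?_ : (x : Fin n) (xs : List (Fin n)) → Dec (x ∈ xs)
_∈?_ = DecMembership._∈?_ _≟_

-- If every point occurred in `xs`, the pigeonhole principle would put two different points at the
-- same position.
avoiding : (xs : List (Fin n)) → length xs < n → ∃[ y ] y ∉ xs
avoiding {n} xs short with any? (λ y → ¬? (y ∈? xs))
... | yes found = found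
... | no none = contradiction same (Fin.<⇒≢ i<j)
  where
  all∈ : ∀ y → y ∈ xs
  all∈ y = decidable-stable (y ∈? xs) (λ y∉ → none (y , y∉))
  collision = pigeonhole short (λ y → index (all∈ y))
  i = proj₁ collision
  j = proj₁ (proj₂ collision)
  i<j = proj₁ (proj₂ (proj₂ collision))
  same : i ≡ j
  same = trans (lookup-index (all∈ i))
    (trans (cong (List.lookup xs) (proj₂ (proj₂ (proj₂ collision)))) (sym (lookup-index (all∈ j))))

module SwapValues (M : Matching (Fin n)) {x y : Fin n} (distinct : OnDistinctEdges M x y) where
  private
    τ = transpose x y
    x≢y = proj₁ distinct
    Mx≢y = proj₂ distinct

  swapped : Matching (Fin n)
  swapped = conj τ M

  private
    via : ∀ {z z′ w} → τ ⟨$⟩ʳ z ≡ z′ → τ ⟨$⟩ʳ mate M z ≡ w → mate swapped z′ ≡ w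
    via refl e = trans (conj-mate τ M _) e

  at-x : mate swapped x ≡ mate M y
  at-x = via (transpose-right x y) (transpose-other (λ e → Mx≢y (mate-flip M e)) (fixfree M y))

  at-y : mate swapped y ≡ mate M x
  at-y = via (transpose-left x y) (transpose-other (fixfree M x) Mx≢y)

  elsewhere : ∀ {z} → z ≢ x → z ≢ y → mate M z ≢ x → mate M z ≢ y → mate swapped z ≡ mate M z
  elsewhere z≢x z≢y Mz≢x Mz≢y = via (transpose-other z≢x z≢y) (transpose-other Mz≢x Mz≢y)

  -- Each of the two new edges contains exactly one end of the edge of `M` at `x`. That edge belongs
  -- to `N`, so the new ones do not; the other edges are unchanged.
  fewer-agreements : ∀ (N : Matching (Fin n)) {xs} → mate M x ≡ mate N x →
    (∀ z → mate M z ≡ mate N z → z ∈ x ∷ xs) → ∀ z → mate swapped z ≡ mate N z → z ∈ xs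
  fewer-agreements N agree-x agree z e = by-cases (z ≟ x) (z ≟ y) (mate M z ≟ x) (mate M z ≟ y)
    where
    by-cases : Dec (z ≡ x) → Dec (z ≡ y) → Dec (mate M z ≡ x) → Dec (mate M z ≡ y) → z ∈ _
    by-cases (yes refl) _ _ _ = contradiction (mate-injective M (trans agree-x (trans (sym e) at-x))) x≢y
    by-cases (no _) (yes refl) _ _ = contradiction (mate-injective N (trans (sym agree-x) (trans (sym at-y) e))) x≢y
    by-cases (no _) (no _) (yes Mz≡x) _ = contradiction (begin
      x               ≡⟨ mate-flip N (sym agree-x) ⟨
      mate N (mate M x) ≡⟨ cong (mate N) (mate-flip M Mz≡x) ⟩
      mate N z          ≡⟨ e ⟨
      mate swapped z    ≡⟨ cong (mate swapped) (mate-flip M Mz≡x) ⟨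
      mate swapped (mate M x)  ≡⟨ mate-flip swapped at-y ⟩
      y ∎) x≢y
      where open ≡-Reasoning
    by-cases (no z≢x) (no _) (no _) (yes Mz≡y) = contradiction (begin
      x                        ≡⟨ mate-flip swapped at-x ⟨
      mate swapped (mate M y)  ≡⟨ cong (mate swapped) (mate-flip M Mz≡y) ⟩
      mate swapped z           ≡⟨ e ⟩
      mate N z                 ∎) (λ x≡Nz → x≢y (mate-injective M
        (trans agree-x (trans (mate-flip N (sym x≡Nz)) (sym (mate-flip M Mz≡y))))))
      where open ≡-Reasoning
    by-cases (no z≢x) (no z≢y) (no Mz≢x) (no Mz≢y)
      with agree z (trans (sym (elsewhere z≢x z≢y Mz≢x Mz≢y)) e)
    ... | here z≡x = contradiction z≡x z≢x
    ... | there i  = i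

-- Exchanging two matchings along a 4-cycle.

switch : (M N : Matching (Fin n)) (zs : List (Fin n)) →
         (∀ {x} → x ∈ zs → mate M x ∈ zs) → (∀ {x} → x ∈ zs → mate N x ∈ zs) → Matching (Fin n)
switch {n} M N zs M-closed N-closed = record
  { mate       = λ x → choose x (x ∈? zs)
  ; involutive = λ x → inv x (x ∈? zs) (choose x (x ∈? zs) ∈? zs)
  ; fixfree    = λ x → free x (x ∈? zs)
  }
  where
  choose : ∀ x → Dec (x ∈ zs) → Fin n
  choose x (yes _) = mate N x
  choose x (no _)  = mate M x
  inv : ∀ x (d : Dec (x ∈ zs)) (d′ : Dec (choose x d ∈ zs)) → choose (choose x d) d′ ≡ x
  inv x (yes i) (yes _) = involutive N x
  inv x (yes i) (no ∉)  = contradiction (N-closed i) ∉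
  inv x (no ∉)  (yes i) = contradiction (subst (_∈ zs) (involutive M x) (M-closed i)) ∉
  inv x (no _)  (no _)  = involutive M x
  free : ∀ x (d : Dec (x ∈ zs)) → choose x d ≢ x
  free x (yes _) = fixfree N x
  free x (no _)  = fixfree M x

module _ (M N : Matching (Fin n)) (zs : List (Fin n))
         (M-closed : ∀ {x} → x ∈ zs → mate M x ∈ zs) (N-closed : ∀ {x} → x ∈ zs → mate N x ∈ zs) where

  switch-inside : ∀ {x} → x ∈ zs → mate (switch M N zs M-closed N-closed) x ≡ mate N x
  switch-inside {x} i with x ∈? zs
  ... | yes _ = refl
  ... | no ∉  = contradiction i ∉

  switch-outside : ∀ {x} → x ∉ zs → mate (switch M N zs M-closed N-closed) x ≡ mate M x
  switch-outside {x} ∉ with x ∈? zs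
  ... | yes i = contradiction i ∉
  ... | no _  = refl

-- Two members of the clique whose union contains the 4-cycle p, M₁ p, M₂ (M₁ p), M₂ p.
record FourCycleClique (n : ℕ) : Set where
  field
    M₁ M₂ : Matching (Fin n)
    rest  : List (Matching (Fin n))
    disjoint₀ : AllPairs Disjoint (M₁ ∷ M₂ ∷ rest)
    p₀    : Fin n
    square : mate M₁ (mate M₂ p₀) ≡ mate M₂ (mate M₁ p₀)

  clique : Clique n
  clique = record { members = M₁ ∷ M₂ ∷ rest ; disjoint = disjoint₀ }

  cycle : List (Fin n)
  cycle = p₀ ∷ mate M₁ p₀ ∷ mate M₂ p₀ ∷ mate M₁ (mate M₂ p₀) ∷ []

  closed₁ : ∀ {x} → x ∈ cycle → mate M₁ x ∈ cycle
  closed₁ (here refl) = there (here refl)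
  closed₁ (there (here refl)) = here (involutive M₁ p₀)
  closed₁ (there (there (here refl))) = there (there (there (here refl)))
  closed₁ (there (there (there (here refl)))) = there (there (here (involutive M₁ _)))

  closed₂ : ∀ {x} → x ∈ cycle → mate M₂ x ∈ cycle
  closed₂ (here refl) = there (there (here refl))
  closed₂ (there (here refl)) = there (there (there (here (sym square))))
  closed₂ (there (there (here refl))) = here (involutive M₂ p₀)
  closed₂ (there (there (there (here refl)))) = there (here (trans (cong (mate M₂) square) (involutive M₂ _)))

  M₁′ M₂′ : Matching (Fin n)
  M₁′ = switch M₁ M₂ cycle closed₁ closed₂
  M₂′ = switch M₂ M₁ cycle closed₂ closed₁

  -- At every point the new pair takes the two values of `M₁` and `M₂` in some order, so
  -- disjointness is inherited.
  switched : Clique n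
  switched .members = M₁′ ∷ M₂′ ∷ rest
  switched .disjoint with disjoint₀
  ... | (d₁₂ ∷ d₁) ∷ d₂ ∷ ds = (d₁₂′ ∷ All.tabulate d₁′) ∷ All.tabulate d₂′ ∷ ds
    where
    d₁₂′ : Disjoint M₁′ M₂′
    d₁₂′ x e with x ∈? cycle
    ... | yes _ = d₁₂ x (sym e)
    ... | no _  = d₁₂ x e
    d₁′ : ∀ {M} → M ∈ rest → Disjoint M₁′ M
    d₁′ i x e with x ∈? cycle
    ... | yes _ = All.lookup d₂ i x e
    ... | no _  = All.lookup d₁ i x e
    d₂′ : ∀ {M} → M ∈ rest → Disjoint M₂′ M
    d₂′ i x e with x ∈? cycle
    ... | yes _ = All.lookup d₁ i x e
    ... | no _  = All.lookup d₂ i x e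

-- Subtracts one equation from the other without leaving the natural numbers.
cancel-crosswise : ∀ a b c d x y → a + x ≡ b + y → c + x ≡ d + y → a + d ≡ b + c
cancel-crosswise a b c d x y e e′ = +-cancelʳ-≡ (x + y) (a + d) (b + c)
  (trans (interchange +-commutativeSemigroup a d x y) (trans (cong₂ _+_ e (sym e′))
    (trans (interchange +-commutativeSemigroup b y c x) (cong (b + c +_) (+-comm y x)))))

-- The mixed second difference of `f` along two disjoint transpositions, written additively because
-- `f` takes values in `ℕ`.
SecondDifferenceVanishes : (Matching (Fin n) → ℕ) → Set
SecondDifferenceVanishes f = ∀ M {p q u v} → OnDistinctEdges M p q →
  OnDistinctEdges M p u → OnDistinctEdges M p v →
  OnDistinctEdges M q u → OnDistinctEdges M q v → OnDistinctEdges M u v →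
  f M + f (conj (transpose p q) (conj (transpose u v) M)) ≡ f (conj (transpose p q) M) + f (conj (transpose u v) M)

module _ (K : FourCycleClique n) (u₀ : Fin n) (u₀∉ : u₀ ∉ FourCycleClique.cycle K)
         (f : Matching (Fin n) → ℕ) (f-cong : ∀ {M N} → M ≈ N → f M ≡ f N)
         (exchange : ∀ π → f (conj π (FourCycleClique.M₁ K)) + f (conj π (FourCycleClique.M₂ K))
                         ≡ f (conj π (FourCycleClique.M₁′ K)) + f (conj π (FourCycleClique.M₂′ K))) where

  open FourCycleClique K

  private
    q₀ = mate M₁ p₀
    v₀ = mate M₁ u₀
    σ = transpose p₀ q₀
    τ = transpose u₀ v₀

    p₀∈ : p₀ ∈ cycle
    p₀∈ = here refl
    v₀∉ : v₀ ∉ cycle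
    v₀∉ i = u₀∉ (subst (_∈ cycle) (involutive M₁ u₀) (closed₁ i))

    separated : ∀ {x y} → x ∈ cycle → y ∉ cycle → OnDistinctEdges M₂ x y
    separated x∈ y∉ = (λ { refl → y∉ x∈ }) , λ { refl → y∉ (closed₂ x∈) }

    M₁≢M₂ : ∀ x → mate M₁ x ≢ mate M₂ x
    M₁≢M₂ with (d ∷ _) ∷ _ ← disjoint₀ = d

    distinct₁ : ∀ x → OnDistinctEdges M₂ x (mate M₁ x)
    distinct₁ x = (λ e → fixfree M₁ x (sym e)) , λ e → M₁≢M₂ x (sym e)

    τM₁ : conj τ M₁ ≈ M₁
    τM₁ = conj-transpose-edge M₁ refl
    τM₁′ : conj τ M₁′ ≈ M₁′
    τM₁′ = conj-transpose-edge M₁′ (switch-outside M₁ M₂ cycle closed₁ closed₂ u₀∉)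
    M₂′p₀ : mate M₂′ p₀ ≡ q₀
    M₂′p₀ = switch-inside M₂ M₁ cycle closed₂ closed₁ p₀∈
    σM₂′ : conj σ M₂′ ≈ M₂′
    σM₂′ = conj-transpose-edge M₂′ M₂′p₀
    -- `τ` fixes `p₀` and `q₀`, so the edge of `M₂′` between them survives in `conj τ M₂′`.
    στM₂′ : conj σ (conj τ M₂′) ≈ conj τ M₂′
    στM₂′ = conj-transpose-edge (conj τ M₂′)
      (trans (cong (mate (conj τ M₂′)) (sym (fixed p₀∈)))
        (trans (conj-mate τ M₂′ p₀) (trans (cong (τ ⟨$⟩ʳ_) M₂′p₀) (fixed (closed₁ p₀∈)))))
      where
      fixed : ∀ {x} → x ∈ cycle → τ ⟨$⟩ʳ x ≡ x
      fixed x∈ = transpose-other (λ { refl → u₀∉ x∈ }) (λ { refl → v₀∉ x∈ })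

    compose : ∀ (ρ π : Permutation′ n) A → f (conj (ρ ∘ₚ π) A) ≡ f (conj π (conj ρ A))
    compose ρ π A = f-cong (λ _ → refl)

    composed : ∀ (ρ π : Permutation′ n) A B C D →
      f (conj (ρ ∘ₚ π) A) + f (conj (ρ ∘ₚ π) B) ≡ f (conj (ρ ∘ₚ π) C) + f (conj (ρ ∘ₚ π) D) →
      f (conj π (conj ρ A)) + f (conj π (conj ρ B)) ≡ f (conj π (conj ρ C)) + f (conj π (conj ρ D))
    composed ρ π A B C D e = trans (sym (cong₂ _+_ (compose ρ π A) (compose ρ π B)))
      (trans e (cong₂ _+_ (compose ρ π C) (compose ρ π D)))

    turn : ∀ {a a′ c c′} b d → a ≡ a′ → c ≡ c′ → a + b ≡ c + d → b + a′ ≡ d + c′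
    turn {a} {c = c} b d refl refl e = trans (+-comm b a) (trans e (+-comm c d))

    module _ (π : Permutation′ n) where
      h : Matching (Fin n) → ℕ
      h A = f (conj π A)

      h-cong : ∀ A B → A ≈ B → h A ≡ h B
      h-cong A B e = f-cong (conj-cong π {A} {B} e)

    -- Compares the exchange identity at `τ ∘ₚ π` with the one at `π`; the terms in `M₁` and `M₁′`
    -- cancel because `τ` fixes both matchings.
    first-difference : ∀ π → h π M₂ + h π (conj τ M₂′) ≡ h π M₂′ + h π (conj τ M₂)
    first-difference π = cancel-crosswise
      (h π M₂) (h π M₂′) (h π (conj τ M₂)) (h π (conj τ M₂′)) (h π M₁) (h π M₁′)
      (turn (h π M₂) (h π M₂′) refl refl (exchange π))
      (turn (h π (conj τ M₂)) (h π (conj τ M₂′)) (h-cong π (conj τ M₁) M₁ τM₁) (h-cong π (conj τ M₁′) M₁′ τM₁′)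
        (composed τ π M₁ M₂ M₁′ M₂′ (exchange (τ ∘ₚ π))))

    -- Compares the first difference at `σ ∘ₚ π` with the one at `π`; now the terms in `M₂′` and
    -- `conj τ M₂′` cancel because `σ` fixes both.
    second-difference : ∀ π → h π M₂ + h π (conj σ (conj τ M₂)) ≡ h π (conj τ M₂) + h π (conj σ M₂)
    second-difference π = cancel-crosswise
      (h π M₂) (h π (conj τ M₂)) (h π (conj σ M₂)) (h π (conj σ (conj τ M₂))) (h π (conj τ M₂′)) (h π M₂′)
      (trans (first-difference π) (+-comm (h π M₂′) (h π (conj τ M₂))))
      (trans (cong (h π (conj σ M₂) +_) (sym (h-cong π (conj σ (conj τ M₂′)) (conj τ M₂′) στM₂′)))
        (trans (composed σ π M₂ (conj τ M₂′) M₂′ (conj τ M₂) (first-difference (σ ∘ₚ π)))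
          (trans (+-comm (h π (conj σ M₂′)) (h π (conj σ (conj τ M₂))))
            (cong (h π (conj σ (conj τ M₂)) +_) (h-cong π (conj σ M₂′) M₂′ σM₂′)))))

  -- `p₀` and `q₀` lie on distinct edges of `M₂` since `M₁` and `M₂` are disjoint; likewise `u₀` and
  -- `v₀`, which are off the cycle. So some `π` carries `M₂` with these four points to `M` with `p`,
  -- `q`, `u`, `v`.
  secondDifferenceVanishes : SecondDifferenceVanishes f
  secondDifferenceVanishes M {p} {q} {u} {v} pq pu pv qu qv uv = conclude
    (transitive-marked M₂ M ((p₀ , p) ∷ (q₀ , q) ∷ (u₀ , u) ∷ (v₀ , v) ∷ [])
      (((distinct₁ p₀ , pq) ∷ (separated p₀∈ u₀∉ , pu) ∷ (separated p₀∈ v₀∉ , pv) ∷ []) ∷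
       ((separated (closed₁ p₀∈) u₀∉ , qu) ∷ (separated (closed₁ p₀∈) v₀∉ , qv) ∷ []) ∷
       ((distinct₁ u₀ , uv) ∷ []) ∷ [] ∷ []))
    where
    σ′ = transpose p q
    τ′ = transpose u v
    conclude : ∃[ π ] (conj π M₂ ≈ M ×
      All (λ e → π ⟨$⟩ʳ proj₁ e ≡ proj₂ e) ((p₀ , p) ∷ (q₀ , q) ∷ (u₀ , u) ∷ (v₀ , v) ∷ [])) →
      f M + f (conj σ′ (conj τ′ M)) ≡ f (conj σ′ M) + f (conj τ′ M)
    conclude (π , πM₂ , πp ∷ πq ∷ πu ∷ πv ∷ []) = begin
      f M + f (conj σ′ (conj τ′ M))                 ≡⟨ cong₂ _+_ (f-cong πM₂) (f-cong πστM₂) ⟨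
      h π M₂ + h π (conj σ (conj τ M₂))             ≡⟨ second-difference π ⟩
      h π (conj τ M₂) + h π (conj σ M₂)             ≡⟨ +-comm (h π (conj τ M₂)) (h π (conj σ M₂)) ⟩
      h π (conj σ M₂) + h π (conj τ M₂)             ≡⟨ cong₂ _+_ (f-cong (pushed πp πq M₂ M πM₂)) (f-cong πτM₂) ⟩
      f (conj σ′ M) + f (conj τ′ M)                 ∎
      where
      open ≡-Reasoning
      pushed : ∀ {i j i′ j′} → π ⟨$⟩ʳ i ≡ i′ → π ⟨$⟩ʳ j ≡ j′ → ∀ A B → conj π A ≈ B →
               conj π (conj (transpose i j) A) ≈ conj (transpose i′ j′) B
      pushed {i} {j} refl refl A B e x = trans (conj-transpose π i j A x)
        (conj-cong (transpose (π ⟨$⟩ʳ i) (π ⟨$⟩ʳ j)) {conj π A} {B} e x)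
      πτM₂ : conj π (conj τ M₂) ≈ conj τ′ M
      πτM₂ = pushed πu πv M₂ M πM₂
      πστM₂ : conj π (conj σ (conj τ M₂)) ≈ conj σ′ (conj τ′ M)
      πστM₂ = pushed πp πq (conj τ M₂) (conj τ′ M) πτM₂

-- Maximum families share an edge

within-tail : ∀ {A : Set} {R : A → Set} {x xs} → ¬ R x → (∀ z → R z → z ∈ x ∷ xs) → ∀ z → R z → z ∈ xs
within-tail ¬Rx ∈x∷xs z r with ∈x∷xs z r
... | here refl = contradiction r ¬Rx
... | there i   = i

bit : ∀ {a} → a ≤ 1 → a ≡ 1 ⊎ a ≡ 0
bit {zero}  _ = inj₂ refl
bit {suc zero} _ = inj₁ refl
bit {suc (suc _)} (s≤s ())

module _ (Fs : List (Matching (Fin n))) (distinct : Distinct Fs)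
         (intersecting : ∀ {P Q} → P ∈ Fs → Q ∈ Fs → Meets P Q)
         (6<n : 6 < n) (vanishes : SecondDifferenceVanishes (count Fs)) where

  private
    f = count Fs

    meet : ∀ {M N} → f M ≡ 1 → f N ≡ 1 → Meets M N
    meet {M} {N} fM fN
      with P , P∈ , M≈P ← count-positive⇒∈ Fs {M} (≤-reflexive (sym fM))
         | Q , Q∈ , N≈Q ← count-positive⇒∈ Fs {N} (≤-reflexive (sym fN))
      with x , e ← intersecting P∈ Q∈ = x , trans (M≈P x) (trans e (sym (N≈Q x)))

  -- A witness that the family is not closed under swaps.
  record Exit (M : Matching (Fin n)) (p q : Fin n) : Set where
    field
      pq  : OnDistinctEdges M p q
      in-family : f M ≡ 1
      leaves : f (conj (transpose p q) M) ≡ 0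

  -- The vanishing second difference reads 1 + b = 0 + d with d at most 1, which leaves only d = 1
  -- and b = 0. Hence an exit survives swaps involving other edges.
  exit-transported : ∀ {M p q} → Exit M p q → ∀ {x y} → OnDistinctEdges M p x → OnDistinctEdges M p y →
    OnDistinctEdges M q x → OnDistinctEdges M q y → (xy : OnDistinctEdges M x y) →
    f (conj (transpose x y) M) ≡ 1 × f (conj (transpose p q) (conj (transpose x y) M)) ≡ 0
  exit-transported {M} {p} {q} ex {x} {y} px py qx qy xy =
    forced in-family leaves (vanishes M pq px py qx qy xy)
      (count≤1 distinct (conj (transpose x y) M))
    where
    open Exit ex
    forced : ∀ {a b c d} → a ≡ 1 → c ≡ 0 → a + b ≡ c + d → d ≤ 1 → d ≡ 1 × b ≡ 0
    forced {b = zero} refl refl e _ = sym e , refl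
    forced {b = suc _} refl refl refl (s≤s ())

  -- If N avoided both edges, swapping the edges shared by M and N with further ones would preserve the exit
  -- until M and N are disjoint.
  exit-meets : ∀ {M p q} → Exit M p q → ∀ {N} → f N ≡ 1 → mate N p ≡ mate M p ⊎ mate N q ≡ mate M q
  exit-meets {M} {p} {q} ex {N} fN with mate N p ≟ mate M p | mate N q ≟ mate M q
  ... | yes e | _     = inj₁ e
  ... | no _  | yes e = inj₂ e
  ... | no Np≢ | no Nq≢ = ⊥-elim (go (allFin n) M ex Np≢ Nq≢ (λ z _ → ∈-allFin z))
    where
    go : ∀ xs M → Exit M p q → mate N p ≢ mate M p → mate N q ≢ mate M q →
         (∀ z → mate M z ≡ mate N z → z ∈ xs) → ⊥
    go [] M ex _ _ agreements with z , e ← meet {M} {N} (Exit.in-family ex) fN with () ← agreements z e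
    go (x ∷ xs) M ex Np≢ Nq≢ agreements with mate M x ≟ mate N x
    ... | no Mx≢Nx = go xs M ex Np≢ Nq≢ (within-tail Mx≢Nx agreements)
    -- `y` has to lie off the edges at `p`, `q` and `x`, which cover at most six points; hence
    -- `6<n`.
    ... | yes Mx≡Nx with avoiding (p ∷ mate M p ∷ q ∷ mate M q ∷ x ∷ mate M x ∷ []) 6<n
    ...   | y , y∉ = go xs (conj (transpose x y) M) exit′
              (λ e → Np≢ (trans e (kept p≢x p≢y Mp≢x Mp≢y))) (λ e → Nq≢ (trans e (kept q≢x q≢y Mq≢x Mq≢y)))
              (fewer-agreements N Mx≡Nx agreements)
      where
      open Exit ex
      p≢x : p ≢ x
      p≢x refl = Np≢ (sym Mx≡Nx)
      q≢x : q ≢ x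
      q≢x refl = Nq≢ (sym Mx≡Nx)
      Mp≢x : mate M p ≢ x
      Mp≢x refl = Np≢ (mate-flip N (trans (sym Mx≡Nx) (involutive M p)))
      Mq≢x : mate M q ≢ x
      Mq≢x refl = Nq≢ (mate-flip N (trans (sym Mx≡Nx) (involutive M q)))
      p≢y : p ≢ y
      p≢y e = y∉ (here (sym e))
      Mp≢y : mate M p ≢ y
      Mp≢y e = y∉ (there (here (sym e)))
      q≢y : q ≢ y
      q≢y e = y∉ (there (there (here (sym e))))
      Mq≢y : mate M q ≢ y
      Mq≢y e = y∉ (there (there (there (here (sym e)))))
      xy : OnDistinctEdges M x y
      xy = (λ e → y∉ (there (there (there (there (here (sym e))))))) ,
           (λ e → y∉ (there (there (there (there (there (here (sym e))))))))
      open SwapValues M xy renaming (elsewhere to kept)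
      moved = exit-transported ex (p≢x , Mp≢x) (p≢y , Mp≢y) (q≢x , Mq≢x) (q≢y , Mq≢y) xy
      exit′ : Exit (conj (transpose x y) M) p q
      exit′ = record
        { pq = proj₁ pq , λ e → proj₂ pq (trans (sym (kept p≢x p≢y Mp≢x Mp≢y)) e)
        ; in-family = proj₁ moved ; leaves = proj₂ moved }

  -- Starting from `N` itself, agreements with `N` are swapped away one by one. If no swap left the
  -- family, this would end at a member disjoint from `N`.
  exit-exists : ∀ N → f N ≡ 1 → ∃[ M ] ∃[ p ] ∃[ q ] Exit M p q
  exit-exists N fN = go (allFin n) N fN (λ z _ → ∈-allFin z)
    where
    go : ∀ xs M → f M ≡ 1 → (∀ z → mate M z ≡ mate N z → z ∈ xs) → ∃[ M ] ∃[ p ] ∃[ q ] Exit M p q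
    go [] M fM agreements with z , e ← meet {M} {N} fM fN with () ← agreements z e
    go (x ∷ xs) M fM agreements with mate M x ≟ mate N x
    ... | no Mx≢Nx = go xs M fM (within-tail Mx≢Nx agreements)
    ... | yes Mx≡Nx with avoiding (x ∷ mate M x ∷ []) (≤-trans (s≤s (s≤s (s≤s z≤n))) 6<n)
    ...   | y , y∉ with bit (count≤1 distinct (conj (transpose x y) M))
    ...     | inj₂ f≡0 = M , x , y , record { pq = xy ; in-family = fM ; leaves = f≡0 }
      where
      xy : OnDistinctEdges M x y
      xy = (λ e → y∉ (here (sym e))) , (λ e → y∉ (there (here (sym e))))
    ...     | inj₁ f≡1 = go xs (conj (transpose x y) M) f≡1 (SwapValues.fewer-agreements M xy N Mx≡Nx agreements)
      where
      xy : OnDistinctEdges M x y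
      xy = (λ e → y∉ (here (sym e))) , (λ e → y∉ (there (here (sym e))))

  -- If some member `N₁` misses the edge of `M` at `p`, it contains the edge at `q` and has an exit
  -- of its own. `exit-meets` for both exits then forces the edge at `q` on every member.
  common-edge : ∀ {N} → N ∈ Fs → ∃[ a ] ∃[ b ] All (λ M → mate M a ≡ b) Fs
  common-edge {N} N∈ with exit-exists N (∈⇒count≡1 distinct {N} N∈ (λ _ → refl))
  ... | M , p , q , ex with All.all? (λ P → mate P p ≟ mate M p) Fs
  ...   | yes all-p = p , mate M p , all-p
  ...   | no ¬all-p with find (All.¬All⇒Any¬ (λ P → mate P p ≟ mate M p) Fs ¬all-p)
  ...     | N₁ , N₁∈ , N₁p≢Mp = q , mate M q , All.tabulate λ {P} P∈ → contains-q P∈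
    where
    open Exit ex
    in-f : ∀ {P} → P ∈ Fs → f P ≡ 1
    in-f {P} P∈ = ∈⇒count≡1 distinct {P} P∈ (λ _ → refl)
    N₁q≡Mq : mate N₁ q ≡ mate M q
    N₁q≡Mq with exit-meets ex {N₁} (in-f N₁∈)
    ... | inj₁ e = contradiction e N₁p≢Mp
    ... | inj₂ e = e
    qp : OnDistinctEdges N₁ q p
    qp = (λ e → proj₁ pq (sym e)) , λ e → proj₂ pq (mate-flip M (trans (sym N₁q≡Mq) e))
    open SwapValues N₁ qp
    -- The swap gives `p` the old mate of `q` and `q` the old mate of `p`, so neither point keeps
    -- its mate in `M` and `exit-meets` rules out membership.
    out : f swapped ≡ 0
    out with bit (count≤1 distinct swapped)
    ... | inj₂ e = e
    ... | inj₁ e with exit-meets ex {swapped} e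
    ...   | inj₁ sp≡Mp = contradiction (mate-injective M (trans (sym sp≡Mp) (trans at-y N₁q≡Mq))) (proj₁ pq)
    ...   | inj₂ sq≡Mq = contradiction (mate-injective N₁ (trans (sym at-x) (trans sq≡Mq (sym N₁q≡Mq)))) (proj₁ pq)
    ex₁ : Exit N₁ q p
    ex₁ = record { pq = qp ; in-family = in-f N₁∈ ; leaves = out }
    contains-q : ∀ {P} → P ∈ Fs → mate P q ≡ mate M q
    contains-q {P} P∈ with exit-meets ex {P} (in-f P∈) | exit-meets ex₁ {P} (in-f P∈)
    ... | inj₂ e | _      = e
    ... | _      | inj₁ e = trans e N₁q≡Mq
    ... | inj₁ e | inj₂ e′ = contradiction (trans (sym e′) e) N₁p≢Mp

-- Near-1-factorizations and cliques containing a 4-cycle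

module Cyclic (k : ℕ) where
  private
    N : ℕ
    N = suc k

  residue : ℕ → Fin N
  residue a = fromℕ< (m%n<n a N)

  toℕ-residue : ∀ a → toℕ (residue a) ≡ a % N
  toℕ-residue a = toℕ-fromℕ< (m%n<n a N)

  residue-cong : ∀ a b → a % N ≡ b % N → residue a ≡ residue b
  residue-cong a b e = toℕ-injective (trans (toℕ-residue a) (trans e (sym (toℕ-residue b))))

  residue-toℕ : ∀ x → residue (toℕ x) ≡ x
  residue-toℕ x = toℕ-injective (trans (toℕ-residue (toℕ x)) (m<n⇒m%n≡m (toℕ<n x)))

  infixl 6 _⊕_ _⊖_

  _⊕_ : Fin N → Fin N → Fin N
  x ⊕ y = residue (toℕ x + toℕ y)

  neg : Fin N → Fin N
  neg x = residue (N ∸ toℕ x)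

  _⊖_ : Fin N → Fin N → Fin N
  x ⊖ y = x ⊕ neg y

  residue-+ : ∀ a b → residue a ⊕ residue b ≡ residue (a + b)
  residue-+ a b = residue-cong (toℕ (residue a) + toℕ (residue b)) (a + b)
    (trans (cong (_% N) (cong₂ _+_ (toℕ-residue a) (toℕ-residue b))) (sym (%-distribˡ-+ a b N)))

  ⊕-comm : ∀ x y → x ⊕ y ≡ y ⊕ x
  ⊕-comm x y = cong residue (+-comm (toℕ x) (toℕ y))

  ⊕-assoc : ∀ x y z → (x ⊕ y) ⊕ z ≡ x ⊕ (y ⊕ z)
  ⊕-assoc x y z = begin
    (x ⊕ y) ⊕ z                                   ≡⟨ cong ((x ⊕ y) ⊕_) (residue-toℕ z) ⟨
    residue (toℕ x + toℕ y) ⊕ residue (toℕ z)     ≡⟨ residue-+ (toℕ x + toℕ y) (toℕ z) ⟩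
    residue (toℕ x + toℕ y + toℕ z)               ≡⟨ cong residue (+-assoc (toℕ x) (toℕ y) (toℕ z)) ⟩
    residue (toℕ x + (toℕ y + toℕ z))             ≡⟨ residue-+ (toℕ x) (toℕ y + toℕ z) ⟨
    residue (toℕ x) ⊕ (y ⊕ z)                     ≡⟨ cong (_⊕ (y ⊕ z)) (residue-toℕ x) ⟩
    x ⊕ (y ⊕ z)                                   ∎
    where open ≡-Reasoning

  ⊕-identityˡ : ∀ x → zero ⊕ x ≡ x
  ⊕-identityˡ = residue-toℕ

  neg-inverseˡ : ∀ x → neg x ⊕ x ≡ zero
  neg-inverseˡ x = begin
    neg x ⊕ x                                   ≡⟨ cong (neg x ⊕_) (residue-toℕ x) ⟨
    residue (N ∸ toℕ x) ⊕ residue (toℕ x)       ≡⟨ residue-+ (N ∸ toℕ x) (toℕ x) ⟩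
    residue (N ∸ toℕ x + toℕ x)                 ≡⟨ cong residue (m∸n+n≡m (<⇒≤ (toℕ<n x))) ⟩
    residue N                                   ≡⟨ residue-cong N 0 (n%n≡0 N) ⟩
    zero                                        ∎
    where open ≡-Reasoning

  abelianGroup : AbelianGroup 0ℓ 0ℓ
  abelianGroup = record
    { Carrier = Fin N ; _≈_ = _≡_ ; _∙_ = _⊕_ ; ε = zero ; _⁻¹ = neg
    ; isAbelianGroup = record
      { isGroup = record
        { isMonoid = record
          { isSemigroup = record
            { isMagma = record { isEquivalence = isEquivalence ; ∙-cong = cong₂ _⊕_ }
            ; assoc = ⊕-assoc }
          ; identity = ⊕-identityˡ , λ x → trans (⊕-comm x zero) (⊕-identityˡ x) }
        ; inverse = neg-inverseˡ , λ x → trans (⊕-comm x (neg x)) (neg-inverseˡ x)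
        ; ⁻¹-cong = cong neg }
      ; comm = ⊕-comm } }

  ⊕-identityʳ : ∀ x → x ⊕ zero ≡ x
  ⊕-identityʳ = AbelianGroup.identityʳ abelianGroup

  ⊕-inverseʳ : ∀ x → x ⊖ x ≡ zero
  ⊕-inverseʳ = AbelianGroup.inverseʳ abelianGroup

  ⊕-cancelˡ : ∀ x y z → x ⊕ y ≡ x ⊕ z → y ≡ z
  ⊕-cancelˡ = AbelianGroupProperties.∙-cancelˡ abelianGroup

  ⊕-cancelʳ : ∀ x y z → y ⊕ x ≡ z ⊕ x → y ≡ z
  ⊕-cancelʳ = AbelianGroupProperties.∙-cancelʳ abelianGroup

  neg-involutive : ∀ x → neg (neg x) ≡ x
  neg-involutive = AbelianGroupProperties.⁻¹-involutive abelianGroup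

  neg-⊕ : ∀ x y → neg x ⊕ neg y ≡ neg (x ⊕ y)
  neg-⊕ = AbelianGroupProperties.⁻¹-∙-comm abelianGroup

  ⊖≡0⇒≡ : ∀ x y → x ⊖ y ≡ zero → x ≡ y
  ⊖≡0⇒≡ = AbelianGroupProperties.x∙y⁻¹≈ε⇒x≈y abelianGroup

  reflect : Fin N → Fin N → Fin N
  reflect i x = i ⊕ i ⊖ x

  reflect-involutive : ∀ i x → reflect i (reflect i x) ≡ x
  reflect-involutive i x = begin
    s ⊕ neg (s ⊕ neg x)         ≡⟨ cong (s ⊕_) (neg-⊕ s (neg x)) ⟨
    s ⊕ (neg s ⊕ neg (neg x))   ≡⟨ ⊕-assoc s (neg s) _ ⟨
    s ⊕ neg s ⊕ neg (neg x)     ≡⟨ cong₂ _⊕_ (⊕-inverseʳ s) (neg-involutive x) ⟩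
    zero ⊕ x                    ≡⟨ ⊕-identityˡ x ⟩
    x                           ∎
    where
    open ≡-Reasoning
    s = i ⊕ i

  ⊖-⊕ : ∀ x y → x ⊖ y ⊕ y ≡ x
  ⊖-⊕ x y = trans (⊕-assoc x (neg y) y) (trans (cong (x ⊕_) (neg-inverseˡ y)) (⊕-identityʳ x))

  ⊕-⊖ : ∀ x y → x ⊕ y ⊖ y ≡ x
  ⊕-⊖ x y = trans (⊕-assoc x y (neg y)) (trans (cong (x ⊕_) (⊕-inverseʳ y)) (⊕-identityʳ x))

  translation : Fin N → Fin N ↔ Fin N
  translation s = mk↔ₛ′ (_⊕ s) (_⊖ s) (λ x → ⊖-⊕ x s) (λ x → ⊕-⊖ x s)

double≡2* : ∀ t → double t ≡ 2 * t
double≡2* zero    = refl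
double≡2* (suc t) = cong suc (trans (cong suc (double≡2* t)) (sym (+-suc t (t + 0))))

module OddCyclic (t : ℕ) where
  open Cyclic (double t) public
  private
    N : ℕ
    N = suc (double t)

  -- The integer 2x is a multiple of N below 2N, hence 0 or N, and N is odd.
  halving₀ : ∀ x → x ⊕ x ≡ zero → x ≡ zero
  halving₀ x e with m%n≡0⇒n∣m (toℕ x + toℕ x) N (trans (sym (toℕ-residue (toℕ x + toℕ x))) (cong toℕ e))
  ... | divides zero 2x≡0 = toℕ-injective (m+n≡0⇒m≡0 (toℕ x) 2x≡0)
  ... | divides (suc zero) 2x≡N = contradiction
    (trans (cong (toℕ x +_) (+-identityʳ (toℕ x))) (trans 2x≡N (trans (+-identityʳ N) (cong suc (double≡2* t)))))
    (even≢odd (toℕ x) t)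
  ... | divides (suc (suc q)) 2x≡qN = contradiction
    (≤-trans (+-monoʳ-≤ N (m≤m+n N (q * N))) (≤-reflexive (sym 2x≡qN)))
    (<⇒≱ (+-mono-< (toℕ<n x) (toℕ<n x)))

  halving : ∀ x y → x ⊕ x ≡ y ⊕ y → x ≡ y
  halving x y e = ⊖≡0⇒≡ x y (halving₀ (x ⊖ y) (begin
    x ⊖ y ⊕ (x ⊖ y)             ≡⟨ ⊕-assoc x (neg y) (x ⊖ y) ⟩
    x ⊕ (neg y ⊕ (x ⊖ y))       ≡⟨ cong (x ⊕_) (⊕-comm (neg y) (x ⊖ y)) ⟩
    x ⊕ (x ⊖ y ⊖ y)             ≡⟨ cong (x ⊕_) (⊕-assoc x (neg y) (neg y)) ⟩
    x ⊕ (x ⊕ (neg y ⊕ neg y))   ≡⟨ ⊕-assoc x x _ ⟨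
    x ⊕ x ⊕ (neg y ⊕ neg y)     ≡⟨ cong₂ _⊕_ e (neg-⊕ y y) ⟩
    y ⊕ y ⊖ (y ⊕ y)             ≡⟨ ⊕-inverseʳ (y ⊕ y) ⟩
    zero                        ∎))
    where open ≡-Reasoning

-- Near matchings, their lifts and gluings.

record NearMatching (n : ℕ) : Set where
  no-eta-equality
  field
    near       : Fin n → Fin n
    near²      : ∀ x → near (near x) ≡ x
    centre     : Fin n
    fixed      : near centre ≡ centre
    only-fixed : ∀ x → near x ≡ x → x ≡ centre

open NearMatching public

NearDisjoint : NearMatching n → NearMatching n → Set
NearDisjoint P Q = ∀ x → near P x ≢ near Q x

centres-differ : ∀ {P Q : NearMatching n} → NearDisjoint P Q → centre P ≢ centre Q
centres-differ {P = P} {Q} d e = d (centre P) (trans (fixed P)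
  (trans e (trans (sym (fixed Q)) (cong (near Q) (sym e)))))

moved : ∀ (P : NearMatching n) {x} → x ≢ centre P → near P x ≢ centre P
moved P {x} x≢c e = x≢c (trans (sym (near² P x)) (trans (cong (near P) e) (fixed P)))

near-conj : Permutation′ n → NearMatching n → NearMatching n
near-conj π P .near x   = π ⟨$⟩ʳ near P (π ⟨$⟩ˡ x)
near-conj π P .near² x  = trans (cong (λ y → π ⟨$⟩ʳ near P y) (inverseˡ π))
  (trans (cong (π ⟨$⟩ʳ_) (near² P _)) (inverseʳ π))
near-conj π P .centre   = π ⟨$⟩ʳ centre P
near-conj π P .fixed    = cong (π ⟨$⟩ʳ_) (trans (cong (near P) (inverseˡ π)) (fixed P))
near-conj π P .only-fixed x e = trans (sym (inverseʳ π)) (cong (π ⟨$⟩ʳ_) (only-fixed P _ (sym (to⇒from π e))))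

-- Replaces the fixed point of `P` by an edge to the outside vertex `v`. The decision is an argument
-- so that proofs can split on it.
glue-half : (P : NearMatching n) → V → (Fin n → V) → (x : Fin n) → Dec (x ≡ centre P) → V
glue-half P v f x (yes _) = v
glue-half P v f x (no _)  = f (near P x)

module _ (P : NearMatching n) {v : V} {f : Fin n → V} where
  glue-half-centre : ∀ d → glue-half P v f (centre P) d ≡ v
  glue-half-centre (yes _) = refl
  glue-half-centre (no ≢)  = contradiction refl ≢

  glue-half-near : ∀ {x} → x ≢ centre P → ∀ d → glue-half P v f x d ≡ f (near P x)
  glue-half-near x≢ (yes e) = contradiction e x≢
  glue-half-near x≢ (no _)  = refl

-- The new point `zero` is ∞, matched with the singleton.
lift : NearMatching n → Matching (Fin (suc n))
lift P .mate zero = suc (centre P)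
lift P .mate (suc x) = glue-half P zero suc x (x ≟ centre P)
lift P .involutive zero = glue-half-centre P (centre P ≟ centre P)
lift P .involutive (suc x) with x ≟ centre P
... | yes e = cong suc (sym e)
... | no x≢c = trans (glue-half-near P (moved P x≢c) (near P x ≟ centre P)) (cong suc (near² P x))
lift P .fixfree zero ()
lift P .fixfree (suc x) e with x ≟ centre P
... | no x≢c = x≢c (only-fixed P x (Fin.suc-injective e))

lift-disjoint : ∀ {P Q : NearMatching n} → NearDisjoint P Q → Disjoint (lift P) (lift Q)
lift-disjoint {P = P} {Q} d zero e = centres-differ {P = P} {Q} d (Fin.suc-injective e)
lift-disjoint {P = P} {Q} d (suc x) e with x ≟ centre P | x ≟ centre Q
... | yes x≡c | yes x≡c′ = centres-differ {P = P} {Q} d (trans (sym x≡c) x≡c′)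
... | no _    | no _     = d x (Fin.suc-injective e)

-- Two near matchings side by side, with an edge joining the two unmatched centres.
glue : NearMatching n → NearMatching n → Matching (Fin n ⊎ Fin n)
glue P Q .mate (inj₁ x) = glue-half P (inj₂ (centre Q)) inj₁ x (x ≟ centre P)
glue P Q .mate (inj₂ y) = glue-half Q (inj₁ (centre P)) inj₂ y (y ≟ centre Q)
glue P Q .involutive (inj₁ x) with x ≟ centre P
... | yes e  = trans (glue-half-centre Q (centre Q ≟ centre Q)) (cong inj₁ (sym e))
... | no x≢c = trans (glue-half-near P (moved P x≢c) (near P x ≟ centre P)) (cong inj₁ (near² P x))
glue P Q .involutive (inj₂ y) with y ≟ centre Q
... | yes e  = trans (glue-half-centre P (centre P ≟ centre P)) (cong inj₂ (sym e))
... | no y≢c = trans (glue-half-near Q (moved Q y≢c) (near Q y ≟ centre Q)) (cong inj₂ (near² Q y))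
glue P Q .fixfree (inj₁ x) e with x ≟ centre P
... | no x≢c = x≢c (only-fixed P x (inj₁-injective e))
glue P Q .fixfree (inj₂ y) e with y ≟ centre Q
... | no y≢c = y≢c (only-fixed Q y (inj₂-injective e))

glue-disjoint : ∀ {P P′ Q Q′ : NearMatching n} → NearDisjoint P P′ → NearDisjoint Q Q′ →
                Disjoint (glue P Q) (glue P′ Q′)
glue-disjoint {P = P} {P′} {Q} {Q′} d d′ (inj₁ x) e with x ≟ centre P | x ≟ centre P′
... | yes _ | yes _ = centres-differ {P = Q} {Q′} d′ (inj₂-injective e)
... | no _  | no _  = d x (inj₁-injective e)
glue-disjoint {P = P} {P′} {Q} {Q′} d d′ (inj₂ y) e with y ≟ centre Q | y ≟ centre Q′
... | yes _ | yes _ = centres-differ {P = P} {P′} d (inj₁-injective e)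
... | no _  | no _  = d′ y (inj₂-injective e)

side-by-side : Matching V → Matching W → Matching (V ⊎ W)
side-by-side M N .mate (inj₁ x) = inj₁ (mate M x)
side-by-side M N .mate (inj₂ y) = inj₂ (mate N y)
side-by-side M N .involutive (inj₁ x) = cong inj₁ (involutive M x)
side-by-side M N .involutive (inj₂ y) = cong inj₂ (involutive N y)
side-by-side M N .fixfree (inj₁ x) e = fixfree M x (inj₁-injective e)
side-by-side M N .fixfree (inj₂ y) e = fixfree N y (inj₂-injective e)

across : V ↔ W → Matching (V ⊎ W)
across β .mate (inj₁ x) = inj₂ (Inverse.to β x)
across β .mate (inj₂ y) = inj₁ (Inverse.from β y)
across β .involutive (inj₁ x) = cong inj₁ (to⇒from β refl)
across β .involutive (inj₂ y) = cong inj₂ (Inverse.inverseˡ β refl)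
across β .fixfree (inj₁ x) ()
across β .fixfree (inj₂ y) ()

across-disjoint : ∀ {β γ : V ↔ W} → (∀ x → Inverse.to β x ≢ Inverse.to γ x) → Disjoint (across β) (across γ)
across-disjoint d (inj₁ x) e = d x (inj₂-injective e)
across-disjoint {β = β} {γ} d (inj₂ y) e = d (Inverse.from β y)
  (trans (Inverse.inverseˡ β refl) (sym (Inverse.inverseˡ γ (inj₁-injective e))))

-- Only the edge joining the centres runs between the two halves, so it is the only one that
-- `across β` could share.
glue-across-disjoint : ∀ {P Q : NearMatching n} {β : Fin n ↔ Fin n} →
                       Inverse.to β (centre P) ≢ centre Q → Disjoint (glue P Q) (across β)
glue-across-disjoint {P = P} {Q} {β} ≢ (inj₁ x) e with x ≟ centre P
... | yes refl = ≢ (sym (inj₂-injective e))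
glue-across-disjoint {P = P} {Q} {β} ≢ (inj₂ y) e with y ≟ centre Q
... | yes refl = ≢ (Inverse.inverseˡ β (inj₁-injective e))

-- The heads of the two families become `M₁` and `M₂`, and their tails the remaining members.
two-families : ∀ {a b} (β : V ↔ Fin n) (f : Fin (suc a) → Matching V) (g : Fin (suc b) → Matching V) →
  (∀ {i j} → i ≢ j → Disjoint (f i) (f j)) → (∀ {i j} → i ≢ j → Disjoint (g i) (g j)) →
  (∀ i j → Disjoint (f i) (g j)) → ∀ p → mate (f zero) (mate (g zero) p) ≡ mate (g zero) (mate (f zero) p) →
  Σ[ K ∈ FourCycleClique n ] length (FourCycleClique.rest K) ≡ a + b
two-families {V = V} {n = n} {a} {b} β f g ff gg fg p square = K , length≡
  where
  fs = List.tabulate (λ i → conj β (f (suc i)))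
  gs = List.tabulate (λ i → conj β (g (suc i)))
  push : ∀ M N → Disjoint M N → Disjoint (conj β M) (conj β N)
  push M N = conj-disjoint β {M} {N}
  K : FourCycleClique n
  K = record
    { M₁ = conj β (f zero) ; M₂ = conj β (g zero) ; rest = fs ++ gs
    ; disjoint₀ =
        (push (f zero) (g zero) (fg zero zero) ∷
          All.++⁺ (All.tabulate⁺ λ i → push (f zero) (f (suc i)) (ff λ ()))
                  (All.tabulate⁺ λ i → push (f zero) (g (suc i)) (fg zero (suc i)))) ∷
        All.++⁺ (All.tabulate⁺ λ i x e → push (f (suc i)) (g zero) (fg (suc i) zero) x (sym e))
                (All.tabulate⁺ λ i → push (g zero) (g (suc i)) (gg λ ())) ∷
        AllPairs.++⁺
          (AllPairs.tabulate⁺ λ {i} {j} i≢j → push (f (suc i)) (f (suc j)) (ff (i≢j ∘ Fin.suc-injective)))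
          (AllPairs.tabulate⁺ λ {i} {j} i≢j → push (g (suc i)) (g (suc j)) (gg (i≢j ∘ Fin.suc-injective)))
          (All.tabulate⁺ λ i → All.tabulate⁺ λ j → push (f (suc i)) (g (suc j)) (fg (suc i) (suc j)))
    ; p₀ = Inverse.to β p
    ; square = trans (cong (mate (conj β (f zero))) (conj-mate β (g zero) p))
        (trans (conj-mate β (f zero) (mate (g zero) p))
          (trans (cong (Inverse.to β) square)
            (sym (trans (cong (mate (conj β (g zero))) (conj-mate β (f zero) p))
              (conj-mate β (g zero) (mate (f zero) p)))))) }
  length≡ : length (fs ++ gs) ≡ a + b
  length≡ = trans (length-++ fs) (cong₂ _+_
    (length-tabulate (λ i → conj β (f (suc i)))) (length-tabulate (λ i → conj β (g (suc i)))))

-- Round-robin cliques and the two 4-cycle constructions.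

module _ (t : ℕ) where
  open OddCyclic t

  -- The map sending x to 2i - x modulo 2t + 1. Doubling is injective modulo an odd number, so `i`
  -- is the only fixed point and different `i` give disjoint maps.
  reflection : Fin (suc (double t)) → NearMatching (suc (double t))
  reflection i .near = reflect i
  reflection i .near² = reflect-involutive i
  reflection i .centre = i
  reflection i .fixed = ⊕-⊖ i i
  reflection i .only-fixed x e = sym (halving i x (trans (sym (⊖-⊕ (i ⊕ i) x)) (cong (_⊕ x) e)))

  reflections-disjoint : ∀ {i j} → i ≢ j → NearDisjoint (reflection i) (reflection j)
  reflections-disjoint {i} {j} i≢j x e = i≢j (halving i j (⊕-cancelʳ (neg x) (i ⊕ i) (j ⊕ j) e))

  -- The classical 1-factorization of the complete graph on 2t + 2 points.
  round-robin : Clique (suc (suc (double t)))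
  round-robin .members  = List.tabulate (λ i → lift (reflection i))
  round-robin .disjoint = AllPairs.tabulate⁺ {f = λ i → lift (reflection i)} λ {i} {j} i≢j →
    lift-disjoint {P = reflection i} {reflection j} (reflections-disjoint i≢j)

  length-round-robin : length (members round-robin) ≡ suc (double t)
  length-round-robin = length-tabulate (λ i → lift (reflection i))

-- With `M₁` and `M₂` the clique has N - 1 members, the size for which the bound is tight.
FourCycle : ℕ → Set
FourCycle N = Σ[ K ∈ FourCycleClique N ] suc (suc (suc (length (FourCycleClique.rest K)))) ≡ N

-- Two halves of even size m = 2t + 2: each of the m - 1 round-robin matchings is used on both
-- halves at once, and the m translations run across. Translation by 0 copies one half to the other,
-- so with any factor it forms 4-cycles.
four-cycle-even : ∀ t → FourCycle (suc (suc (double t)) + suc (suc (double t)))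
four-cycle-even t = proj₁ K , (begin
  suc (suc (suc _))                         ≡⟨ cong (3 +_) (proj₂ K) ⟩
  suc (suc (suc (double t + suc (double t))))    ≡⟨ cong (2 +_) (+-suc (double t) (suc (double t))) ⟨
  suc (suc (double t)) + suc (suc (double t))    ∎)
  where
  open ≡-Reasoning
  open Cyclic (suc (double t))
  factor : Fin (suc (double t)) → Matching (Fin (suc (suc (double t))) ⊎ Fin (suc (suc (double t))))
  factor i = side-by-side (lift (reflection t i)) (lift (reflection t i))
  factors-disjoint : ∀ {i j} → i ≢ j → Disjoint (factor i) (factor j)
  factors-disjoint {i} {j} i≢j (inj₁ x) e =
    lift-disjoint {P = reflection t i} {reflection t j} (reflections-disjoint t i≢j) x (inj₁-injective e)
  factors-disjoint {i} {j} i≢j (inj₂ x) e =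
    lift-disjoint {P = reflection t i} {reflection t j} (reflections-disjoint t i≢j) x (inj₂-injective e)
  K = two-families (↔-sym +↔⊎) factor (λ s → across (translation s))
    factors-disjoint
    (λ {i} {j} i≢j → across-disjoint {β = translation i} {translation j} (λ x e → i≢j (⊕-cancelˡ x i j e)))
    (λ { i j (inj₁ x) () ; i j (inj₂ x) () })
    (inj₁ zero)
    (cong inj₂ (trans (cong (mate (lift (reflection t zero))) (⊕-identityʳ zero)) (sym (⊕-identityʳ _))))

-- Twisting the reflections on one side by the transposition (0 1) creates the 4-cycle
-- (0,2), (0,−2), (1,−1), (1,3).
four-cycle-odd : ∀ r → let m = suc (double (suc (suc r))) in FourCycle (m + m)
four-cycle-odd r = proj₁ K , trans (cong (3 +_) (proj₂ K))
  (cong suc (sym (trans (+-suc (double t) (double t)) (cong suc (+-suc (double t) b)))))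
  where
  t = suc (suc r)
  b = suc (suc (suc (double r)))
  m = suc (double t)
  open OddCyclic t
  one two three : Fin m
  one   = suc zero
  two   = suc (suc zero)
  three = suc (suc (suc zero))
  τ = transpose zero one
  -- Indexing by `τ ⟨$⟩ʳ i` puts the centre back at `i`, so that `factor i` joins the two copies of
  -- `i`.
  twisted : Fin m → NearMatching m
  twisted i = near-conj (flip τ) (reflection t (τ ⟨$⟩ʳ i))
  centre-twisted : ∀ i → centre (twisted i) ≡ i
  centre-twisted i = inverseˡ τ
  twisted-disjoint : ∀ {i j} → i ≢ j → NearDisjoint (twisted i) (twisted j)
  twisted-disjoint {i} {j} i≢j x e = reflections-disjoint t (i≢j ∘ to-injective τ) (τ ⟨$⟩ʳ x) (from-injective τ e)
  factor : Fin m → Matching (Fin m ⊎ Fin m)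
  factor i = glue (reflection t i) (twisted i)
  -- Translation by 0 is left out: its edges join the two copies of each `i`, and those are the
  -- centre edges of the factors.
  shift : Fin (suc b) → Matching (Fin m ⊎ Fin m)
  shift s = across (translation (suc s))
  neg-one≢ : ∀ {x} → one ⊕ x ≢ zero → neg one ≢ x
  neg-one≢ ≢0 refl = ≢0 (⊕-inverseʳ one)
  -- `τ` sends the centre 0 to 1, so 3 goes to 2 - 3 = -1; `τ` fixes both 3 and -1.
  twisted-three : near (twisted zero) three ≡ neg one
  twisted-three = begin
    τ ⟨$⟩ˡ reflect (τ ⟨$⟩ʳ zero) (τ ⟨$⟩ʳ three)  ≡⟨ cong (τ ⟨$⟩ˡ_) two-minus-three ⟩
    τ ⟨$⟩ˡ neg one                              ≡⟨ to⇒from τ (transpose-other (neg-one≢ (λ ())) (neg-one≢ (λ ()))) ⟩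
    neg one                                     ∎
    where
    open ≡-Reasoning
    two-minus-three : two ⊖ three ≡ neg one
    two-minus-three = begin
      two ⊕ neg (two ⊕ one)          ≡⟨ cong (two ⊕_) (neg-⊕ two one) ⟨
      two ⊕ (neg two ⊕ neg one)      ≡⟨ ⊕-assoc two (neg two) (neg one) ⟨
      two ⊖ two ⊕ neg one            ≡⟨ cong (_⊕ neg one) (⊕-inverseʳ two) ⟩
      zero ⊕ neg one                 ≡⟨ ⊕-identityˡ (neg one) ⟩
      neg one                        ∎
  minus-two-plus-one : reflect zero two ⊕ one ≡ neg one
  minus-two-plus-one = begin
    zero ⊕ neg (one ⊕ one) ⊕ one    ≡⟨ cong (_⊕ one) (⊕-identityˡ (neg two)) ⟩
    neg (one ⊕ one) ⊕ one           ≡⟨ cong (_⊕ one) (neg-⊕ one one) ⟨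
    neg one ⊖ one ⊕ one             ≡⟨ ⊖-⊕ (neg one) one ⟩
    neg one                         ∎
    where open ≡-Reasoning
  K : Σ[ K ∈ FourCycleClique (m + m) ] length (FourCycleClique.rest K) ≡ double t + b
  K = two-families (↔-sym +↔⊎) factor shift
    (λ {i} {j} i≢j → glue-disjoint {P = reflection t i} {reflection t j} {twisted i} {twisted j}
      (reflections-disjoint t i≢j) (twisted-disjoint i≢j))
    (λ {i} {j} i≢j → across-disjoint {β = translation (suc i)} {translation (suc j)}
      (λ x e → i≢j (Fin.suc-injective (⊕-cancelˡ x (suc i) (suc j) e))))
    (λ i s → glue-across-disjoint {P = reflection t i} {twisted i} {translation (suc s)}
      (λ e → contradiction (⊕-cancelˡ i (suc s) zero
        (trans e (trans (centre-twisted i) (sym (⊕-identityʳ i))))) λ ()))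
    (inj₁ two)
    (begin
      mate (factor zero) (inj₂ three)
        ≡⟨ glue-half-near (twisted zero) {inj₁ zero} {inj₂}
             (λ e → contradiction (trans e (centre-twisted zero)) λ ()) (three ≟ centre (twisted zero)) ⟩
      inj₂ (near (twisted zero) three)
        ≡⟨ cong inj₂ (trans twisted-three (sym minus-two-plus-one)) ⟩
      inj₂ (reflect zero two ⊕ one)
        ≡⟨ cong (mate (shift zero))
             (glue-half-near (reflection t zero) {inj₂ (centre (twisted zero))} {inj₁} (λ ()) (two ≟ zero)) ⟨
      mate (shift zero) (mate (factor zero) (inj₁ two))
        ∎)
    where open ≡-Reasoning

half : ∀ k → ∃[ t ] (k ≡ double t ⊎ k ≡ suc (double t))
half zero = zero , inj₁ refl
half (suc k) with half k
... | t , inj₁ e = t , inj₂ (cong suc e)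
... | t , inj₂ e = suc t , inj₁ (cong suc e)

double≡+ : ∀ m → double m ≡ m + m
double≡+ m = trans (double≡2* m) (cong (m +_) (+-identityʳ m))

-- The parity of the half size k + 1 selects the construction. The odd one works with 0, 1, 2, 3 and
-- -1 as distinct residues, available from k + 1 = 5 on.
four-cycle : ∀ k → 3 ≤ k → FourCycle (double (suc k))
four-cycle k 3≤k with half k
... | t , inj₂ refl = subst FourCycle (sym (double≡+ (suc k))) (four-cycle-even t)
... | zero , inj₁ refl with () ← 3≤k
... | suc zero , inj₁ refl with s≤s (s≤s ()) ← 3≤k
... | suc (suc r) , inj₁ refl = subst FourCycle (sym (double≡+ (suc k))) (four-cycle-odd r)

double-mono-≤ : ∀ {a b} → a ≤ b → double a ≤ double b
double-mono-≤ z≤n     = z≤n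
double-mono-≤ (s≤s l) = s≤s (s≤s (double-mono-≤ l))

-- Six points, the bound, and the equality case for matchings.

meets? : (M N : Matching (Fin n)) → Dec (Meets M N)
meets? M N = any? (λ x → mate M x ≟ mate N x)

CommonEdge : Matching (Fin n) → Matching (Fin n) → Matching (Fin n) → Set
CommonEdge P Q R = ∃[ x ] (mate P x ≡ mate Q x × mate P x ≡ mate R x)

TriplesMeet : List (Matching (Fin n)) → Set
TriplesMeet L = All (λ P → All (λ Q → All (λ R → Meets P Q → Meets P R → Meets Q R → CommonEdge P Q R) L) L) L

-- All the properties involved depend on mates only, so a check on representatives up to `≈` settles
-- every triple.
common-edge-from-representatives : ∀ (L : List (Matching (Fin n))) → (∀ M → ∃[ N ] (N ∈ L × M ≈ N)) → TriplesMeet L →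
  ∀ P Q R → Meets P Q → Meets P R → Meets Q R → CommonEdge P Q R
common-edge-from-representatives L rep triples P Q R (a , Pa≡Qa) (b , Pb≡Rb) (c , Qc≡Rc)
  with P′ , P′∈ , P≈ ← rep P | Q′ , Q′∈ , Q≈ ← rep Q | R′ , R′∈ , R≈ ← rep R
  with x , Px≡Qx , Px≡Rx ← All.lookup (All.lookup (All.lookup triples P′∈) Q′∈) R′∈
         (a , trans (sym (P≈ a)) (trans Pa≡Qa (Q≈ a)))
         (b , trans (sym (P≈ b)) (trans Pb≡Rb (R≈ b)))
         (c , trans (sym (Q≈ c)) (trans Qc≡Rc (R≈ c)))
  = x , trans (P≈ x) (trans Px≡Qx (sym (Q≈ x))) , trans (P≈ x) (trans Px≡Rx (sym (R≈ x)))

-- Decided by evaluation over all triples from the list of 15 matchings.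
triples-of-K₆ : TriplesMeet (matchings 3)
triples-of-K₆ = toWitness {a? = All.all? (λ P → All.all? (λ Q → All.all? (λ R →
  meets? P Q →-dec (meets? P R →-dec (meets? Q R →-dec
    any? (λ x → (mate P x ≟ mate Q x) ×-dec (mate P x ≟ mate R x)))))
  (matchings 3)) (matchings 3)) (matchings 3)} _

common-edge-K₆ : ∀ (P Q R : Matching (Fin 6)) → Meets P Q → Meets P R → Meets Q R → CommonEdge P Q R
common-edge-K₆ = common-edge-from-representatives (matchings 3) (matchings-complete 3) triples-of-K₆

cancel-rest : ∀ a b c d r → a + (b + r) ≡ 1 → c + (d + r) ≡ 1 → a + b ≡ c + d
cancel-rest a b c d r e e′ = +-cancelʳ-≡ r (a + b) (c + d)
  (trans (+-assoc a b r) (trans (trans e (sym e′)) (sym (+-assoc c d r))))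

module _ (k : ℕ) (Fs : List (Matching (Fin (double (suc (suc k)))))) (distinct : Distinct Fs)
         (intersecting : ∀ {P Q} → P ∈ Fs → Q ∈ Fs → Meets P Q) where

  -- The round-robin clique on 2k + 4 points has 2k + 3 members, and this factor cancels from (2k +
  -- 3)!!.
  intersecting-bound : length Fs ≤ suc (double k) !!
  intersecting-bound = *-cancelˡ-≤ (suc (double (suc k))) (≤-trans
    (≤-reflexive (cong (_* length Fs) (sym (length-round-robin (suc k)))))
    (clique-coclique Fs distinct intersecting (round-robin (suc k))))

  four-cycle⇒common-edge : FourCycle (double (suc (suc k))) → 2 ≤ k → length Fs ≡ suc (double k) !! →
                           ∀ {N} → N ∈ Fs → ∃[ a ] ∃[ b ] All (λ M → mate M a ≡ b) Fs
  four-cycle⇒common-edge (K , size) 2≤k max =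
    common-edge Fs distinct intersecting 6<N (λ M {p} {q} {u} {v} → vanishes M {p} {q} {u} {v})
    where
    open FourCycleClique K
    6<N : 6 < double (suc (suc k))
    6<N = ≤-trans (n≤1+n 7) (double-mono-≤ {4} (s≤s (s≤s 2≤k)))
    tight : ∀ C → suc (length (members C)) ≡ double (suc (suc k)) → ∀ π → counts Fs distinct intersecting C π ≡ 1
    tight C sizeC = clique-coclique-tight Fs distinct intersecting C
      (≤-reflexive (sym (cong₂ _*_ (cong (_∸ 1) sizeC) max)))
    -- Both cliques have N - 1 members, so every translate of either meets the family exactly once;
    -- the common `rest` cancels.
    exchange : ∀ π → count Fs (conj π M₁) + count Fs (conj π M₂) ≡ count Fs (conj π M₁′) + count Fs (conj π M₂′)
    exchange π = cancel-rest
      (count Fs (conj π M₁)) (count Fs (conj π M₂)) (count Fs (conj π M₁′)) (count Fs (conj π M₂′))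
      (∑ rest (λ P → count Fs (conj π P)))
      (tight clique size π) (tight switched size π)
    outside : ∃[ y ] y ∉ cycle
    outside = avoiding cycle (≤-trans (s≤s (s≤s (s≤s (s≤s (s≤s z≤n))))) 6<N)
    vanishes : SecondDifferenceVanishes (count Fs)
    vanishes = secondDifferenceVanishes K (proj₁ outside) (proj₂ outside) (count Fs)
      (λ {M} {N} → count-cong Fs {M} {N}) exchange

maximum⇒common-edge : ∀ k (Fs : List (Matching (Fin (double (suc (suc k)))))) → Distinct Fs →
  (∀ {P Q} → P ∈ Fs → Q ∈ Fs → Meets P Q) → 1 ≤ k → length Fs ≡ suc (double k) !! →
  ∃[ a ] ∃[ b ] All (λ M → mate M a ≡ b) Fs
-- On six points the maximum is 3!! = 3, so the family consists of exactly three matchings.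
maximum⇒common-edge (suc zero) (P ∷ Q ∷ R ∷ []) _ meet _ refl = spread
  (common-edge-K₆ P Q R (meet (here refl) (there (here refl)))
    (meet (here refl) (there (there (here refl)))) (meet (there (here refl)) (there (there (here refl)))))
  where
  spread : CommonEdge P Q R → ∃[ a ] ∃[ b ] All (λ M → mate M a ≡ b) (P ∷ Q ∷ R ∷ [])
  spread (x , Px≡Qx , Px≡Rx) = x , mate P x , refl ∷ sym Px≡Qx ∷ sym Px≡Rx ∷ []
maximum⇒common-edge (suc (suc k)) [] _ _ _ _ = zero , zero , []
maximum⇒common-edge (suc (suc k)) (M ∷ Fs) distinct meet _ max =
  four-cycle⇒common-edge (suc (suc k)) (M ∷ Fs) distinct meet
    (four-cycle (suc (suc (suc k))) (s≤s (s≤s (s≤s z≤n)))) (s≤s (s≤s z≤n)) max (here refl)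

-- Partitions and orbits of Young subgroups

toNear : (P : Partner n) → IsQ P → NearMatching n
toNear P (inv , c , Pc≡c , only-c) = record
  { near = lookup P ; near² = inv ; centre = c ; fixed = Pc≡c ; only-fixed = only-c }

near-isQ : (P : NearMatching n) → IsQ (Vec.tabulate (near P))
near-isQ P =
  (λ x → trans (cong (lookup (Vec.tabulate (near P))) (lookup∘tabulate (near P) x))
    (trans (lookup∘tabulate (near P) _) (near² P x))) ,
  centre P , trans (lookup∘tabulate (near P) _) (fixed P) ,
  λ y e → only-fixed P y (trans (sym (lookup∘tabulate (near P) y)) e)

agree⇒share : ∀ {P Q : Partner n} x → lookup P x ≡ lookup Q x → ShareBlock P Q
agree⇒share x e = x , tabulate-cong (λ y → cong (λ z → ⌊ y ≟ x ⌋ ∨ ⌊ y ≟ z ⌋) e)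

∈-block : ∀ (P : Partner n) x y → lookup (blockOf P x) y ≡ true → y ≡ x ⊎ y ≡ lookup P x
∈-block P x y e with trans (sym (lookup∘tabulate (λ y → ⌊ y ≟ x ⌋ ∨ ⌊ y ≟ lookup P x ⌋) y)) e
... | e′ with y ≟ x | y ≟ lookup P x
...   | yes y≡x | _      = inj₁ y≡x
...   | no _    | yes y≡ = inj₂ y≡
...   | no _    | no _   with () ← e′

mate∈block : ∀ (P : Partner n) x → lookup (blockOf P x) (lookup P x) ≡ true
mate∈block P x = trans (lookup∘tabulate (λ y → ⌊ y ≟ x ⌋ ∨ ⌊ y ≟ lookup P x ⌋) (lookup P x))
  (by-cases (lookup P x ≟ x))
  where
  by-cases : (d : Dec (lookup P x ≡ x)) → ⌊ d ⌋ ∨ ⌊ lookup P x ≟ lookup P x ⌋ ≡ true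
  by-cases (yes _) = refl
  by-cases (no _)  = trans (isYes≗does (lookup P x ≟ lookup P x)) (dec-true (lookup P x ≟ lookup P x) refl)

-- `lookup P x` lies in the block of `x` in `Q`, and `lookup Q x` in that of `P`. Either one is the
-- other's value, or both equal `x`.
share⇒agree : ∀ {P Q : Partner n} → ShareBlock P Q → ∃[ x ] lookup P x ≡ lookup Q x
share⇒agree {P = P} {Q} (x , e)
  with ∈-block Q x (lookup P x) (trans (cong (λ B → lookup B (lookup P x)) (sym e)) (mate∈block P x))
     | ∈-block P x (lookup Q x) (trans (cong (λ B → lookup B (lookup Q x)) e) (mate∈block Q x))
... | inj₂ Px≡Qx | _          = x , Px≡Qx
... | inj₁ _     | inj₂ Qx≡Px = x , sym Qx≡Px
... | inj₁ Px≡x  | inj₁ Qx≡x  = x , trans Px≡x (sym Qx≡x)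

module _ (P Q : NearMatching n) where
  lift-agree⁺ : ∀ {x} → near P x ≡ near Q x → mate (lift P) (suc x) ≡ mate (lift Q) (suc x)
  lift-agree⁺ {x} e with x ≟ centre P | x ≟ centre Q
  ... | yes _    | yes _   = refl
  ... | no _     | no _    = cong suc e
  ... | yes refl | no x≢c  = contradiction (only-fixed Q x (trans (sym e) (fixed P))) x≢c
  ... | no x≢c   | yes refl = contradiction (only-fixed P x (trans e (fixed Q))) x≢c

  lift-agree⁻ : ∀ {x} → mate (lift P) (suc x) ≡ mate (lift Q) (suc x) → near P x ≡ near Q x
  lift-agree⁻ {x} e with x ≟ centre P | x ≟ centre Q
  ... | yes refl | yes x≡c  = trans (fixed P) (trans x≡c (trans (sym (fixed Q)) (cong (near Q) (sym x≡c))))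
  ... | no _     | no _     = Fin.suc-injective e

-- An edge of the lifts becomes a block of the partitions; an edge to ∞ becomes the singleton,
-- recorded as a fixed point.
lift-edge : ∀ a b → ∃[ x ] ∃[ y ] (∀ (P : NearMatching n) → mate (lift P) (suc a) ≡ b → near P x ≡ y)
lift-edge a zero = a , a , fixed-point
  where
  fixed-point : ∀ P → mate (lift P) (suc a) ≡ zero → near P a ≡ a
  fixed-point P e with a ≟ centre P
  ... | yes refl = fixed P
lift-edge a (suc b) = a , b , pair
  where
  pair : ∀ P → mate (lift P) (suc a) ≡ suc b → near P a ≡ b
  pair P e with a ≟ centre P
  ... | no _ = Fin.suc-injective e

lift-edge′ : ∀ a b → ∃[ x ] ∃[ y ] (∀ (P : NearMatching (suc n)) → mate (lift P) a ≡ b → near P x ≡ y)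
lift-edge′ zero    (suc c) = c , c , λ P e → subst (λ z → near P z ≡ z) (Fin.suc-injective e) (fixed P)
lift-edge′ zero    zero    = zero , zero , λ P ()
lift-edge′ (suc a) b       = lift-edge a b

lifts : (F : List (Partner n)) → All IsQ F → List (Matching (Fin (suc n)))
lifts []      []       = []
lifts (P ∷ F) (q ∷ qs) = lift (toNear P q) ∷ lifts F qs

length-lifts : ∀ (F : List (Partner n)) qs → length (lifts F qs) ≡ length F
length-lifts []      []       = refl
length-lifts (P ∷ F) (q ∷ qs) = cong suc (length-lifts F qs)

∈-lifts : ∀ (F : List (Partner n)) qs {M} → M ∈ lifts F qs → ∃[ P ] (P ∈ F × ∃[ q ] M ≡ lift (toNear P q))
∈-lifts (P ∷ F) (q ∷ qs) (here refl) = P , here refl , q , refl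
∈-lifts (P ∷ F) (q ∷ qs) (there i) with P′ , P′∈ , rest ← ∈-lifts F qs i = P′ , there P′∈ , rest

lift-injective : ∀ {P Q : Partner n} q q′ → lift (toNear P q) ≈ lift (toNear Q q′) → P ≡ Q
lift-injective {P = P} {Q} q q′ e = trans (sym (tabulate∘lookup P))
  (trans (tabulate-cong (λ x → lift-agree⁻ (toNear P q) (toNear Q q′) (e (suc x)))) (tabulate∘lookup Q))

lifts-distinct : ∀ {F : List (Partner n)} qs → Unique F → Distinct (lifts F qs)
lifts-distinct []       []       = []
lifts-distinct {F = P ∷ F} (q ∷ qs) (P∉ ∷ u) = All.tabulate fresh ∷ lifts-distinct qs u
  where
  fresh : ∀ {M} → M ∈ lifts F qs → ¬ lift (toNear P q) ≈ M
  fresh i e with Q , Q∈ , q′ , refl ← ∈-lifts F qs i = All.lookup P∉ Q∈ (lift-injective q q′ e)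

lifts-meet : ∀ {F : List (Partner n)} qs → Intersecting F →
             ∀ {M N} → M ∈ lifts F qs → N ∈ lifts F qs → Meets M N
lifts-meet {F = F} qs inter i j
  with P , P∈ , q , refl ← ∈-lifts F qs i | Q , Q∈ , q′ , refl ← ∈-lifts F qs j
  with x , e ← share⇒agree {P = P} {Q} (inter P∈ Q∈)
  = suc x , lift-agree⁺ (toNear P q) (toNear Q q′) e

lifts-edge : ∀ {F : List (Partner (suc n))} qs {a b} → All (λ M → mate M a ≡ b) (lifts F qs) →
             ∃[ x ] ∃[ y ] All (λ P → lookup P x ≡ y) F
lifts-edge qs {a} {b} all with x , y , edge ← lift-edge′ a b = x , y , go qs all
  where
  go : ∀ {F} qs → All (λ M → mate M a ≡ b) (lifts F qs) → All (λ P → lookup P x ≡ y) F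
  go []       []       = []
  go {P ∷ _} (q ∷ qs) (e ∷ es) = edge (toNear P q) e ∷ go qs es

-- For `a ≡ b` the common block is a singleton.
IsStar : Fin n → Fin n → List (Partner n) → Set
IsStar a b F = ∀ Q → Q ∈ F ⇔ (IsQ Q × lookup Q a ≡ b)

module _ (k : ℕ) where
  private
    Family = List (Partner (suc (double (suc k))))

  partition-bound : (F : Family) → All IsQ F → Unique F → Intersecting F → length F ≤ suc (double k) !!
  partition-bound F qs u inter = subst (_≤ suc (double k) !!) (length-lifts F qs)
    (intersecting-bound k (lifts F qs) (lifts-distinct qs u) (lifts-meet qs inter))

  maximum⇒star : 1 ≤ k → (F : Family) → All IsQ F → Unique F → Intersecting F →
                 length F ≡ suc (double k) !! → ∃[ a ] ∃[ b ] IsStar a b F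
  maximum⇒star 1≤k F qs u inter max
    with x , y , es ← maximum⇒common-edge k (lifts F qs) (lifts-distinct qs u) (lifts-meet qs inter) 1≤k
           (trans (length-lifts F qs) max)
    with a , b , all ← lifts-edge {F = F} qs es
    = a , b , λ Q → mk⇔ (λ i → All.lookup qs i , All.lookup all i) λ (q , e) → complete Q q e all
    where
    -- Adding to F another partition with the common edge would give an intersecting family exceeding the bound.
    complete : ∀ {a b} Q → IsQ Q → lookup Q a ≡ b → All (λ P → lookup P a ≡ b) F → Q ∈ F
    complete {a} Q q e all with DecMembership._∈?_ (≡-dec _≟_) Q F
    ... | yes i  = i
    ... | no Q∉F = contradiction
      (partition-bound (Q ∷ F) (q ∷ qs) (All.¬Any⇒All¬ F Q∉F ∷ u)
        (λ {P} {P′} i j → agree⇒share {P = P} {P′} a (trans (All.lookup (e ∷ all) i) (sym (All.lookup (e ∷ all) j)))))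
      (<⇒≱ (≤-reflexive (cong suc (sym max))))

-- Stars as orbits of conjugates of Young subgroups.

module _ {a b : Fin n} {F : List (Partner n)} (star : IsStar a b F)
         (m : ℕ) (g : Permutation′ n) (young : ∀ z → toℕ (g ⟨$⟩ʳ z) < m ⇔ (z ≢ a × z ≢ b)) where

  private
    pair : ∀ {z} → ¬ (z ≢ a × z ≢ b) → z ≡ a ⊎ z ≡ b
    pair {z} ¬≢ with z ≟ a | z ≟ b
    ... | yes e | _     = inj₁ e
    ... | no _  | yes e = inj₂ e
    ... | no z≢a | no z≢b = contradiction (z≢a , z≢b) ¬≢

    stable : ∀ {z} → (z ≡ a ⊎ z ≡ b) → ¬ (z ≢ a × z ≢ b)
    stable (inj₁ e) (z≢a , _) = z≢a e
    stable (inj₂ e) (_ , z≢b) = z≢b e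

    fixing⇒young : ∀ σ → σ ⟨$⟩ʳ a ≡ a → σ ⟨$⟩ʳ b ≡ b → Conj g (Young m) σ
    fixing⇒young σ σa σb x = mk⇔
      (λ x<m → let z≢a , z≢b = Equivalence.to (young z) (subst (λ y → toℕ y < m) (sym (inverseʳ g)) x<m) in
        Equivalence.from (young (σ ⟨$⟩ʳ z))
          ((λ e → z≢a (to-injective σ (trans e (sym σa)))) , (λ e → z≢b (to-injective σ (trans e (sym σb))))))
      (λ σx<m → let σz≢a , σz≢b = Equivalence.to (young (σ ⟨$⟩ʳ z)) σx<m in
        subst (λ y → toℕ y < m) (inverseʳ g) (Equivalence.from (young z)
          ((λ e → σz≢a (trans (cong (σ ⟨$⟩ʳ_) e) σa)) , (λ e → σz≢b (trans (cong (σ ⟨$⟩ʳ_) e) σb)))))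
      where z = g ⟨$⟩ˡ x

    -- By `young`, `g` carries the complement of {a, b} onto the points below `m`, so the conjugate
    -- subgroup is the setwise stabilizer of {a, b}.
    young⇒pair : ∀ σ → Conj g (Young m) σ → ∀ z → (z ≡ a ⊎ z ≡ b) ⇔ (σ ⟨$⟩ʳ z ≡ a ⊎ σ ⟨$⟩ʳ z ≡ b)
    young⇒pair σ h z = mk⇔
      (λ z∈ → pair λ σz∉ → stable z∈ (Equivalence.to (young z) (Equivalence.from (h (g ⟨$⟩ʳ z))
        (subst (λ y → toℕ (g ⟨$⟩ʳ (σ ⟨$⟩ʳ y)) < m) (sym (inverseˡ g)) (Equivalence.from (young (σ ⟨$⟩ʳ z)) σz∉)))))
      (λ σz∈ → pair λ z∉ → stable σz∈ (Equivalence.to (young (σ ⟨$⟩ʳ z))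
        (subst (λ y → toℕ (g ⟨$⟩ʳ (σ ⟨$⟩ʳ y)) < m) (inverseˡ g)
          (Equivalence.to (h (g ⟨$⟩ʳ z)) (Equivalence.from (young z) z∉)))))

    -- Both `σ` and `P` preserve {a, b}; the cases are whether `σ` fixes or exchanges the two
    -- points.
    star-conjugate : ∀ σ P → Conj g (Young m) σ →
      (∀ x → lookup P (lookup P x) ≡ x) → lookup P a ≡ b → σ ⟨$⟩ʳ lookup P (σ ⟨$⟩ˡ a) ≡ b
    star-conjugate σ P h P² Pa≡b with Equivalence.from (young⇒pair σ h (σ ⟨$⟩ˡ a)) (inj₁ (inverseʳ σ))
    ... | inj₁ w≡a with Equivalence.to (young⇒pair σ h b) (inj₂ refl)
    ...   | inj₂ σb≡b = trans (cong (σ ⟨$⟩ʳ_) (trans (cong (lookup P) w≡a) Pa≡b)) σb≡b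
    ...   | inj₁ σb≡a = trans (cong (σ ⟨$⟩ʳ_) (trans (cong (lookup P) w≡a) Pa≡b))
              (trans σb≡a (sym (trans (sym (to⇒from σ σb≡a)) w≡a)))
    star-conjugate σ P h P² Pa≡b | inj₂ w≡b with Equivalence.to (young⇒pair σ h a) (inj₁ refl)
    ...   | inj₂ σa≡b = trans (cong (σ ⟨$⟩ʳ_) Pw≡a) σa≡b
      where
      Pw≡a = trans (cong (lookup P) (trans w≡b (sym Pa≡b))) (P² a)
    ...   | inj₁ σa≡a = trans (cong (σ ⟨$⟩ʳ_) Pw≡a) (trans σa≡a (trans (sym (to⇒from σ σa≡a)) w≡b))
      where
      Pw≡a = trans (cong (lookup P) (trans w≡b (sym Pa≡b))) (P² a)

  -- Transposing the centres gives both partitions the same singleton. Then `conjugating` carries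
  -- one to the other without moving points of agreement, in particular `a` and `b`.
  connecting : ∀ (P Q : NearMatching n) → near P a ≡ b → near Q a ≡ b →
    ∃[ σ ] (σ ⟨$⟩ʳ a ≡ a × σ ⟨$⟩ʳ b ≡ b × (∀ x → σ ⟨$⟩ʳ near P x ≡ near Q (σ ⟨$⟩ʳ x)))
  connecting P Q Pa≡b Qa≡b =
      τ ∘ₚ h ,
      trans (cong (h ⟨$⟩ʳ_) τa) (fixes a P′a≡Qa) ,
      trans (cong (h ⟨$⟩ʳ_) τb) (fixes b (trans (P′-of τb) (trans (cong (τ ⟨$⟩ʳ_) Pb≡a) (trans τa (sym Qb≡a))))) ,
      λ x → trans (cong (h ⟨$⟩ʳ_) (sym (P′-of refl))) (intertwines (τ ⟨$⟩ʳ x))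
    where
    τ = transpose (centre P) (centre Q)
    P′ = near-conj τ P
    Pb≡a : near P b ≡ a
    Pb≡a = trans (cong (near P) (sym Pa≡b)) (near² P a)
    Qb≡a : near Q b ≡ a
    Qb≡a = trans (cong (near Q) (sym Qa≡b)) (near² Q a)
    P′-of : ∀ {x y} → τ ⟨$⟩ʳ x ≡ y → near P′ y ≡ τ ⟨$⟩ʳ near P x
    P′-of refl = cong (λ z → τ ⟨$⟩ʳ near P z) (inverseˡ τ)
    -- A point where `P` and `Q` agree is the centre of both or of neither.
    τ-fixes : ∀ {x y} → near P x ≡ y → near Q x ≡ y → τ ⟨$⟩ʳ x ≡ x
    τ-fixes {x} Px≡y Qx≡y = by-cases (x ≟ centre P) (x ≟ centre Q)
      where
      by-cases : Dec (x ≡ centre P) → Dec (x ≡ centre Q) → τ ⟨$⟩ʳ x ≡ x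
      by-cases (no x≢c) (no x≢c′) = transpose-other x≢c x≢c′
      by-cases (yes refl) _       = trans (transpose-left x (centre Q))
        (sym (only-fixed Q x (trans Qx≡y (trans (sym Px≡y) (fixed P)))))
      by-cases (no x≢c) (yes refl) = contradiction (only-fixed P x (trans Px≡y (trans (sym Qx≡y) (fixed Q)))) x≢c
    τa = τ-fixes Pa≡b Qa≡b
    τb = τ-fixes Pb≡a Qb≡a
    P′a≡Qa : near P′ a ≡ near Q a
    P′a≡Qa = trans (P′-of τa) (trans (cong (τ ⟨$⟩ʳ_) Pa≡b) (trans τb (sym Qa≡b)))
    τc : centre P′ ≡ centre Q
    τc = transpose-left (centre P) (centre Q)
    same-centre : ∀ x → near P′ x ≡ near Q x ⊎ (near P′ x ≢ x × near Q x ≢ x)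
    same-centre x = by-cases (x ≟ centre Q)
      where
      by-cases : Dec (x ≡ centre Q) → near P′ x ≡ near Q x ⊎ (near P′ x ≢ x × near Q x ≢ x)
      by-cases (yes refl) = inj₁ (trans (cong (near P′) (sym τc)) (trans (fixed P′) (trans τc (sym (fixed Q)))))
      by-cases (no x≢c)   = inj₂ ((λ e → x≢c (trans (only-fixed P′ x e) τc)) , λ e → x≢c (only-fixed Q x e))
    conjugation = conjugating (near P′) (near Q) (near² P′) (near² Q) same-centre
    h = proj₁ conjugation
    intertwines = proj₁ (proj₂ conjugation)
    fixes = proj₂ (proj₂ conjugation)

  star-orbit : ∀ {P} → P ∈ F → IsOrbit (Conj g (Young m)) F
  star-orbit {P} P∈ = P , q , λ Q → mk⇔ (to Q) from
    where
    q = proj₁ (Equivalence.to (star P) P∈)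
    Pa≡b = proj₂ (Equivalence.to (star P) P∈)
    to : ∀ Q → Q ∈ F → ∃[ σ ] (Conj g (Young m) σ × Q ≡ act σ P)
    to Q Q∈ with q′ , Qa≡b ← Equivalence.to (star Q) Q∈
      with σ , σa , σb , intertwines ← connecting (toNear P q) (toNear Q q′) Pa≡b Qa≡b
      = σ , fixing⇒young σ σa σb , trans (sym (tabulate∘lookup Q))
          (tabulate-cong λ x → sym (trans (intertwines (σ ⟨$⟩ˡ x)) (cong (lookup Q) (inverseʳ σ))))
    from : ∀ {Q} → ∃[ σ ] (Conj g (Young m) σ × Q ≡ act σ P) → Q ∈ F
    from (σ , h , refl) = Equivalence.from (star (act σ P))
      (near-isQ (near-conj σ (toNear P q)) , trans (lookup∘tabulate _ a) (star-conjugate σ P h (proj₁ q) Pa≡b))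

below-last : ∀ d (y : Fin (suc d)) → toℕ y < d ⇔ y ≢ fromℕ d
below-last d y = mk⇔
  (λ y<d e → ℕ.<⇒≢ y<d (trans (cong toℕ e) (toℕ-fromℕ d)))
  (λ y≢ → ≤∧≢⇒< (≤-pred (toℕ<n y)) (λ e → y≢ (toℕ-injective (trans e (sym (toℕ-fromℕ d))))))

below-last-two : ∀ d (y : Fin (suc (suc d))) → toℕ y < d ⇔ (y ≢ fromℕ (suc d) × y ≢ inject₁ (fromℕ d))
below-last-two d y = mk⇔
  (λ y<d → (λ e → ℕ.<⇒≢ (≤-trans y<d (n≤1+n d)) (trans (cong toℕ e) (toℕ-fromℕ (suc d)))) ,
           (λ e → ℕ.<⇒≢ y<d (trans (cong toℕ e) toℕ-last)))
  (λ (y≢ , y≢′) → ≤∧≢⇒< (≤-pred (Equivalence.from (below-last (suc d) y) y≢))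
                    (λ e → y≢′ (toℕ-injective (trans e (sym toℕ-last)))))
  where
  toℕ-last : toℕ (inject₁ (fromℕ d)) ≡ d
  toℕ-last = trans (toℕ-inject₁ (fromℕ d)) (toℕ-fromℕ d)

moves-to : ∀ {π : Permutation′ n} {a c} → π ⟨$⟩ʳ a ≡ c → ∀ z → π ⟨$⟩ʳ z ≢ c ⇔ z ≢ a
moves-to {π = π} πa z = mk⇔
  (λ πz≢ e → πz≢ (trans (cong (π ⟨$⟩ʳ_) e) πa))
  (λ z≢ e → z≢ (to-injective π (trans e (sym πa))))

-- A common singleton belongs to the Young subgroup of shape [2k, 1] and a common pair to that of
-- shape [2k - 1, 2], where d = 2k - 1; `g` moves the block to the last points.
star⇒orbit : ∀ d {a b : Fin (suc (suc d))} {F} → IsStar a b F → ∀ {P} → P ∈ F →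
  ∃[ g ] (IsOrbit (Conj g (Young (suc d))) F ⊎ IsOrbit (Conj g (Young d)) F)
star⇒orbit d {a} {b} star P∈ with a ≟ b
... | yes refl = g , inj₁ (star-orbit star (suc d) g young P∈)
  where
  last = fromℕ (suc d)
  g = transpose a last
  young : ∀ z → toℕ (g ⟨$⟩ʳ z) < suc d ⇔ (z ≢ a × z ≢ a)
  young z = mk⇔
    (λ l → let z≢a = Equivalence.to moves (Equivalence.to (below-last (suc d) _) l) in z≢a , z≢a)
    (λ (z≢a , _) → Equivalence.from (below-last (suc d) _) (Equivalence.from moves z≢a))
    where
    moves : g ⟨$⟩ʳ z ≢ last ⇔ z ≢ a
    moves = moves-to {π = g} (transpose-left a last) z
... | no a≢b = g , inj₂ (star-orbit star d g young P∈)
  where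
  last = fromℕ (suc d)
  prev = inject₁ (fromℕ d)
  g₁ = transpose a last
  b₁ = g₁ ⟨$⟩ʳ b
  -- First `a` goes to the last point; then the image of `b` goes to the last but one, and the last
  -- point stays.
  g = g₁ ∘ₚ transpose b₁ prev
  last≢prev : last ≢ prev
  last≢prev e = ℕ.<⇒≢ (n<1+n d) (sym (trans (sym (toℕ-fromℕ (suc d)))
    (trans (cong toℕ e) (trans (toℕ-inject₁ (fromℕ d)) (toℕ-fromℕ d)))))
  ga : g ⟨$⟩ʳ a ≡ last
  ga = trans (cong (transpose b₁ prev ⟨$⟩ʳ_) (transpose-left a last))
    (transpose-other (λ e → a≢b (to-injective g₁ (trans (transpose-left a last) e))) last≢prev)
  gb : g ⟨$⟩ʳ b ≡ prev
  gb = transpose-left b₁ prev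
  young : ∀ z → toℕ (g ⟨$⟩ʳ z) < d ⇔ (z ≢ a × z ≢ b)
  young z = mk⇔
    (λ l → let l₁ , l₂ = Equivalence.to (below-last-two d _) l in
      Equivalence.to (moves-to {π = g} ga z) l₁ , Equivalence.to (moves-to {π = g} gb z) l₂)
    (λ (z≢a , z≢b) → Equivalence.from (below-last-two d _)
      (Equivalence.from (moves-to {π = g} ga z) z≢a , Equivalence.from (moves-to {π = g} gb z) z≢b))

-- Assembling the bound and the characterization of equality.

1≤!! : ∀ m → 1 ≤ m !!
1≤!! zero          = s≤s z≤n
1≤!! (suc zero)    = s≤s z≤n
1≤!! (suc (suc m)) = *-mono-≤ {1} {suc (suc m)} (s≤s z≤n) (1≤!! m)

inhabited : ∀ {A : Set} (F : List A) → 1 ≤ length F → ∃[ P ] P ∈ F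
inhabited (P ∷ F) _ = P , here refl

-- `d` is a variable with an equation, so that matching on `refl` passes from `2 * suc k` to
-- `double (suc k)` in all types at once.
bound-and-maximum : ∀ k d → d ≡ double (suc k) → 1 ≤ k → (F : List (Partner (suc d))) →
  All IsQ F → Unique F → Intersecting F →
  length F ≤ (d ∸ 1) !! ×
  (length F ≡ (d ∸ 1) !! → ∃[ g ] (IsOrbit (Conj g (Young d)) F ⊎ IsOrbit (Conj g (Young (d ∸ 1))) F))
bound-and-maximum k d refl 1≤k F qs u inter = partition-bound k F qs u inter , λ max →
  let a , b , star = maximum⇒star k 1≤k F qs u inter max
      P , P∈ = inhabited F (≤-trans (1≤!! (suc (double k))) (≤-reflexive (sym max)))
  in star⇒orbit (suc (double k)) star P∈

theorem9p4 : (k : ℕ) → 2 ≤ k → (F : List (Partner (suc (2 * k)))) →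
    All IsQ F → Unique F → Intersecting F →
    (length F ≤ (2 * k ∸ 1) !!) × ((length F ≡ (2 * k ∸ 1) !!) ⇔ Extremal k F)
theorem9p4 (suc k) (s≤s 1≤k) F qs u inter = bound , mk⇔ (λ max → max , maximum max) proj₁
  where
  both = bound-and-maximum k (2 * suc k) (sym (double≡2* (suc k))) 1≤k F qs u inter
  bound = proj₁ both
  maximum = proj₂ both
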